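{- For any integers $k>l\ge 2$, as $n\to\infty$, $$ex(n,C_{2l+1},\{C_3,C_4,\dots,C_{2l}\}\cup\{C_{2k+1}\})=\Omega(n^{1+\frac{1}{2k+2}})\quad\text{and}\quad ex(n,C_{2l+1},\{C_3,C_4,\dots,C_{2l}\}\cup\{C_{2k+1}\})=O(n^{2}).$$
   Context: $C_k$ denotes the cycle with $k$ vertices. For a graph $H$ and a family of graphs $\mathcal F$, $ex(n,H,\mathcal F)$ is the maximum number of subgraphs isomorphic to $H$ in an $n$-vertex graph containing no member of $\mathcal F$ as a subgraph. -}

module Defs where

open import Data.Bool using (true; false)
open import Data.Nat using (ℕ; zero; suc; _+_; _*_; _∸_; _^_; _≤_; _<_; NonZero)
import Data.Nat as ℕ
import Data.Nat.Properties as ℕₚ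
open import Data.Fin using (Fin; toℕ)
import Data.Fin.Properties as Finₚ
open import Data.Fin.Subset using (Subset; inside; outside) renaming (_∈_ to _∈ˢ_)
open import Data.Fin.Subset.Properties using (_∈?_)
open import Data.Vec using (Vec; []; _∷_; lookup; tabulate)
import Data.Vec.Properties as Vecₚ
open import Data.List using (List; []; _∷_; [_]; _++_; map; filter; length; applyUpTo; allFin; cartesianProduct; cartesianProductWith)
open import Data.List.Properties using (filter-≐)
open import Data.List.Extrema.Nat using (max; v≤max⁺; argmax-sel)
open import Data.List.Membership.Propositional using (_∈_; lose)
open import Data.List.Membership.Propositional.Properties
  using (∈-map⁺; ∈-map⁻; ∈-filter⁺; ∈-filter⁻; ∈-cartesianProduct⁺; ∈-cartesianProductWith⁺; ∈-allFin)
open import Data.List.Relation.Unary.All as All using (All)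
open import Data.List.Relation.Unary.Any as Any using (Any; here; there)
open import Data.List.Relation.Unary.AllPairs using ([]; _∷_)
open import Data.List.Relation.Unary.Unique.Propositional using (Unique)
import Data.List.Relation.Unary.Unique.Propositional.Properties as Uniqueₚ
open import Data.Product using (∃; ∃-syntax; _×_; _,_; proj₁; proj₂)
open import Data.Sum as Sum using (_⊎_; inj₁; inj₂)
open import Function using (_∘_; id; Injective)
open import Function.Bundles using (_⇔_; mk⇔; Equivalence)
open import Level using (Level; 0ℓ)
open import Relation.Binary.Core using (Rel)
open import Relation.Binary.Definitions using (Decidable; Symmetric)
open import Relation.Binary.PropositionalEquality
  using (_≡_; _≢_; refl; sym; trans; cong; subst; subst₂)
open import Relation.Nullary using (¬_; Dec; yes; no; does; ¬?)
open import Relation.Nullary.Decidable using (map′; _×-dec_; _⊎-dec_; _→-dec_; dec-true)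
import Relation.Unary as U

private
  variable
    a : Level
    A : Set a
    n h : ℕ

record Graph (n : ℕ) : Set₁ where
  field
    Adj    : Rel (Fin n) 0ℓ
    adj?   : Decidable Adj
    symm   : Symmetric Adj
    irrefl : ∀ i → ¬ Adj i i

open Graph public

-- Vertex set and adjacency matrix (row i is the neighbourhood of i).  These
-- are plain data, so that distinct subgraphs are those unequal under _≡_.
SubgraphData : ℕ → Set
SubgraphData n = Subset n × Vec (Subset n) n

Vertex : SubgraphData n → Fin n → Set
Vertex (V , _) i = i ∈ˢ V

Edge : SubgraphData n → Rel (Fin n) 0ℓ
Edge (_ , E) i j = j ∈ˢ lookup E i

record IsSubgraph (G : Graph n) (S : SubgraphData n) : Set where
  field
    edge-sym  : ∀ i j → Edge S i j → Edge S j i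
    edge-ends : ∀ i j → Edge S i j → Vertex S i
    edge-sub  : ∀ i j → Edge S i j → Adj G i j

record IsIsomorphism (H : Graph h) (S : SubgraphData n) (f : Fin h → Fin n) : Set where
  field
    injective : Injective _≡_ _≡_ f
    into      : ∀ x → Vertex S (f x)
    onto      : ∀ i → Vertex S i → ∃[ x ] f x ≡ i
    edges     : ∀ x y → Adj H x y ⇔ Edge S (f x) (f y)

_≅_ : Graph h → SubgraphData n → Set
H ≅ S = ∃[ f ] IsIsomorphism H S f

IsCopy : Graph h → Graph n → SubgraphData n → Set
IsCopy H G S = IsSubgraph G S × H ≅ S

Contains : Graph n → Graph h → Set
Contains G F = ∃[ S ] IsCopy F G S

Family : Set₁
Family = List (∃ Graph)

Free : Family → Graph n → Set₁
Free 𝓕 G = All (λ (_ , F) → ¬ Contains G F) 𝓕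

-- The path 0, 1, …, k - 1 closed up by the edge {k - 1, 0}.  The condition
-- i ≢ j only matters for k = 1; C k is the k-cycle for k ≥ 3.
Next : (k : ℕ) → Rel (Fin k) 0ℓ
Next k i j = suc (toℕ i) ≡ toℕ j ⊎ (suc (toℕ i) ≡ k × toℕ j ≡ 0)

C : (k : ℕ) → Graph k
C k = record
  { Adj    = λ i j → i ≢ j × (Next k i j ⊎ Next k j i)
  ; adj?   = λ i j → ¬? (i Finₚ.≟ j) ×-dec (next? i j ⊎-dec next? j i)
  ; symm   = λ (i≢j , e) → i≢j ∘ sym , Sum.swap e
  ; irrefl = λ _ (i≢i , _) → i≢i refl
  }
  where
  next? : Decidable (Next k)
  next? i j = (suc (toℕ i) ℕ.≟ toℕ j) ⊎-dec ((suc (toℕ i) ℕ.≟ k) ×-dec (toℕ j ℕ.≟ 0))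

vectors : List A → (n : ℕ) → List (Vec A n)
vectors xs zero    = [ [] ]
vectors xs (suc n) = cartesianProductWith _∷_ xs (vectors xs n)

∈-vectors : {xs : List A} → (∀ x → x ∈ xs) → (v : Vec A n) → v ∈ vectors xs n
∈-vectors all []      = here refl
∈-vectors all (x ∷ v) = ∈-cartesianProductWith⁺ _∷_ (all x) (∈-vectors all v)

vectors-unique : {xs : List A} → Unique xs → ∀ n → Unique (vectors xs n)
vectors-unique u zero    = All.[] ∷ []
vectors-unique u (suc n) =
  Uniqueₚ.cartesianProductWith⁺ _∷_ Vecₚ.∷-injective u (vectors-unique u n)

subsets : (n : ℕ) → List (Subset n)
subsets = vectors (inside ∷ outside ∷ [])

∈-subsets : (p : Subset n) → p ∈ subsets n
∈-subsets = ∈-vectors λ { true → here refl ; false → there (here refl) }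

subsets-unique : ∀ n → Unique (subsets n)
subsets-unique = vectors-unique (((λ ()) All.∷ All.[]) ∷ All.[] ∷ [])

subgraphData : (n : ℕ) → List (SubgraphData n)
subgraphData n = cartesianProduct (subsets n) (vectors (subsets n) n)

∈-subgraphData : (S : SubgraphData n) → S ∈ subgraphData n
∈-subgraphData (V , E) = ∈-cartesianProduct⁺ (∈-subsets V) (∈-vectors ∈-subsets E)

subgraphData-unique : ∀ n → Unique (subgraphData n)
subgraphData-unique n =
  Uniqueₚ.cartesianProduct⁺ (subsets-unique n) (vectors-unique (subsets-unique n) n)

fromMatrix : Vec (Subset n) n → Graph n
fromMatrix M = record
  { Adj    = λ i j → i ≢ j × (j ∈ˢ lookup M i × i ∈ˢ lookup M j)
  ; adj?   = λ i j → ¬? (i Finₚ.≟ j) ×-dec ((j ∈? lookup M i) ×-dec (i ∈? lookup M j))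
  ; symm   = λ (i≢j , p , q) → i≢j ∘ sym , q , p
  ; irrefl = λ _ (i≢i , _) → i≢i refl
  }

-- Every graph on Fin n, up to equivalence of adjacency relations
-- (see ∈-graphs below).
graphs : (n : ℕ) → List (Graph n)
graphs n = map fromMatrix (vectors (subsets n) n)

private
  anyIn? : {P : A → Set} (xs : List A) → (∀ x → x ∈ xs) → U.Decidable P → Dec (∃ P)
  anyIn? xs all P? = map′ Any.satisfied (λ (x , p) → lose (all x) p) (Any.any? P? xs)

isSubgraph? : (G : Graph n) → U.Decidable (IsSubgraph G)
isSubgraph? G S@(V , E) =
  map′ (λ (p , q , r) → record { edge-sym = p ; edge-ends = q ; edge-sub = r })
       (λ s → let open IsSubgraph s in edge-sym , edge-ends , edge-sub)
       ((∀₂? λ i j → edge? i j →-dec edge? j i) ×-dec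
        (∀₂? λ i j → edge? i j →-dec (i ∈? V)) ×-dec
        (∀₂? λ i j → edge? i j →-dec adj? G i j))
  where
  edge? : Decidable (Edge S)
  edge? i j = j ∈? lookup E i
  ∀₂? : {R : Rel (Fin _) 0ℓ} → Decidable R → Dec (∀ i j → R i j)
  ∀₂? R? = Finₚ.all? λ i → Finₚ.all? (R? i)

isIsomorphism? : (H : Graph h) (S : SubgraphData n) → U.Decidable (IsIsomorphism H S)
isIsomorphism? H S@(V , E) f =
  map′ (λ (p , q , r , s) → record
         { injective = λ {x} {y} → p x y ; into = q ; onto = r
         ; edges = λ x y → mk⇔ (proj₁ (s x y)) (proj₂ (s x y)) })
       (λ iso → let open IsIsomorphism iso in
         (λ _ _ → injective) , into , onto ,
         (λ x y → Equivalence.to (edges x y) , Equivalence.from (edges x y)))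
       ((Finₚ.all? λ x → Finₚ.all? λ y → (f x Finₚ.≟ f y) →-dec (x Finₚ.≟ y)) ×-dec
        (Finₚ.all? λ x → f x ∈? V) ×-dec
        (Finₚ.all? λ i → (i ∈? V) →-dec Finₚ.any? λ x → f x Finₚ.≟ i) ×-dec
        (Finₚ.all? λ x → Finₚ.all? λ y →
          (adj? H x y →-dec edge? (f x) (f y)) ×-dec
          (edge? (f x) (f y) →-dec adj? H x y)))
  where
  edge? : Decidable (Edge S)
  edge? i j = j ∈? lookup E i

isIsomorphism-resp : {H : Graph h} {S : SubgraphData n} {f g : Fin h → Fin n} →
                     (∀ x → f x ≡ g x) → IsIsomorphism H S f → IsIsomorphism H S g
isIsomorphism-resp {H = H} {S} f≗g iso = record
  { injective = λ {x} {y} e → injective (trans (f≗g x) (trans e (sym (f≗g y))))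
  ; into      = λ x → subst (Vertex S) (f≗g x) (into x)
  ; onto      = λ i i∈S → let (x , e) = onto i i∈S in x , trans (sym (f≗g x)) e
  ; edges     = λ x y → subst₂ (λ i j → Adj H x y ⇔ Edge S i j) (f≗g x) (f≗g y) (edges x y)
  }
  where open IsIsomorphism iso

≅? : (H : Graph h) (S : SubgraphData n) → Dec (H ≅ S)
≅? {h} {n} H S =
  map′ (λ (v , iso) → lookup v , iso)
       (λ (f , iso) → tabulate f ,
         isIsomorphism-resp {H = H} {S} (λ x → sym (Vecₚ.lookup∘tabulate f x)) iso)
       (anyIn? (vectors (allFin n) h) (∈-vectors ∈-allFin)
         (λ v → isIsomorphism? H S (lookup v)))

isCopy? : (H : Graph h) (G : Graph n) → U.Decidable (IsCopy H G)
isCopy? H G S = isSubgraph? G S ×-dec ≅? H S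

contains? : (G : Graph n) (F : Graph h) → Dec (Contains G F)
contains? {n} G F = anyIn? (subgraphData n) ∈-subgraphData (isCopy? F G)

free? : (𝓕 : Family) → U.Decidable (Free {n} 𝓕)
free? 𝓕 G = All.all? (λ (_ , F) → ¬? (contains? G F)) 𝓕

-- The number of subgraphs of G isomorphic to H.
copies : Graph h → Graph n → ℕ
copies {n = n} H G = length (filter (isCopy? H G) (subgraphData n))

-- The base value 0 of max is returned only if no graph on n vertices is
-- 𝓕-free, or if no such graph contains H; see ex-upper and ex-attained.
ex : ℕ → Graph h → Family → ℕ
ex n H 𝓕 = max 0 (map (copies H) (filter (free? 𝓕) (graphs n)))

_≈_ : Graph n → Graph n → Set
G ≈ G′ = ∀ i j → Adj G i j ⇔ Adj G′ i j

∈-graphs : (G : Graph n) → ∃[ G′ ] G′ ∈ graphs n × G ≈ G′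
∈-graphs {n} G =
  fromMatrix M , ∈-map⁺ fromMatrix (∈-vectors ∈-subsets M) , λ i j → mk⇔ (to i j) (from i j)
  where
  M : Vec (Subset n) n
  M = tabulate λ i → tabulate λ j → does (adj? G i j)
  entry : ∀ i j → lookup (lookup M i) j ≡ does (adj? G i j)
  entry i j = trans (cong (λ p → lookup p j) (Vecₚ.lookup∘tabulate _ i)) (Vecₚ.lookup∘tabulate _ j)
  row⁺ : ∀ i j → Adj G i j → j ∈ˢ lookup M i
  row⁺ i j e = Vecₚ.lookup⇒[]= j _ (trans (entry i j) (dec-true (adj? G i j) e))
  row⁻ : ∀ i j → j ∈ˢ lookup M i → Adj G i j
  row⁻ i j j∈ with adj? G i j | trans (sym (entry i j)) (Vecₚ.[]=⇒lookup j∈)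
  ... | yes e | _  = e
  ... | no _  | ()
  to : ∀ i j → Adj G i j → Adj (fromMatrix M) i j
  to i j e = (λ { refl → irrefl G i e }) , row⁺ i j e , row⁺ j i (symm G e)
  from : ∀ i j → Adj (fromMatrix M) i j → Adj G i j
  from i j (_ , p , _) = row⁻ i j p

isCopy-resp-≈ : (H : Graph h) {G G′ : Graph n} → G ≈ G′ →
                ∀ {S} → IsCopy H G S → IsCopy H G′ S
isCopy-resp-≈ H G≈G′ (sub , iso) = record
  { edge-sym  = edge-sym
  ; edge-ends = edge-ends
  ; edge-sub  = λ i j e → Equivalence.to (G≈G′ i j) (edge-sub i j e)
  } , iso
  where open IsSubgraph sub

≈-sym : {G G′ : Graph n} → G ≈ G′ → G′ ≈ G
≈-sym e i j = mk⇔ (Equivalence.from (e i j)) (Equivalence.to (e i j))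

copies-resp-≈ : (H : Graph h) {G G′ : Graph n} → G ≈ G′ → copies H G ≡ copies H G′
copies-resp-≈ {n = n} H {G} {G′} e =
  cong length (filter-≐ (isCopy? H G) (isCopy? H G′)
    ( isCopy-resp-≈ H {G} {G′} e
    , isCopy-resp-≈ H {G′} {G} (≈-sym {G = G} {G′} e))
    (subgraphData n))

free-resp-≈ : (𝓕 : Family) {G G′ : Graph n} → G ≈ G′ → Free 𝓕 G → Free 𝓕 G′
free-resp-≈ 𝓕 {G} {G′} e =
  All.map λ { {_ , F} F⊈G (S , c) → F⊈G (S , isCopy-resp-≈ F {G′} {G} (≈-sym {G = G} {G′} e) c) }

ex-upper : (H : Graph h) (𝓕 : Family) (G : Graph n) → Free 𝓕 G → copies H G ≤ ex n H 𝓕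
ex-upper {n = n} H 𝓕 G free with ∈-graphs G
... | G′ , G′∈ , e = v≤max⁺ 0 _ (inj₂ (lose
        (∈-map⁺ (copies H) (∈-filter⁺ (free? 𝓕) G′∈ (free-resp-≈ 𝓕 {G} {G′} e free)))
        (ℕₚ.≤-reflexive (copies-resp-≈ H {G} {G′} e))))

ex-attained : (H : Graph h) (𝓕 : Family) (G₀ : Graph n) → Free 𝓕 G₀ →
              ∃[ G ] Free {n} 𝓕 G × copies H G ≡ ex n H 𝓕
ex-attained {n = n} H 𝓕 G₀ free₀
  with argmax-sel id 0 (map (copies H) (filter (free? 𝓕) (graphs n)))
... | inj₁ ex≡0 = G₀ , free₀ ,
        trans (ℕₚ.n≤0⇒n≡0 (subst (copies H G₀ ≤_) ex≡0 (ex-upper H 𝓕 G₀ free₀))) (sym ex≡0)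
... | inj₂ ex∈ with ∈-map⁻ (copies H) ex∈
...   | G , G∈ , eq = G , proj₂ (∈-filter⁻ (free? 𝓕) {xs = graphs n} G∈) , sym eq

-- {C₃, C₄, …, C₂ₗ} ∪ {C₂ₖ₊₁}
forbidden : (k l : ℕ) → Family
forbidden k l = applyUpTo (λ i → 3 + i , C (3 + i)) (2 * l ∸ 2) ++ [ 2 * k + 1 , C (2 * k + 1) ]

-- f(n) = O(n^p)
_=O[n^_] : (ℕ → ℕ) → ℕ → Set
f =O[n^ p ] = ∃[ c ] ∃[ N ] ∀ n → N ≤ n → f n ≤ c * n ^ p

-- f(n) = Ω(n^(p/q)): eventually f(n) ≥ (1/c) · n^(p/q), with both sides
-- raised to the power q.  Every positive real constant is at least some 1/c.
_=Ω[n^_/_] : (ℕ → ℕ) → ℕ → (q : ℕ) → .{{NonZero q}} → Set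
f =Ω[n^ p / q ] = ∃[ c ] 0 < c × ∃[ N ] ∀ n → N ≤ n → n ^ p ≤ (c * f n) ^ q

{-# OPTIONS --safe #-}
module Submission where

-- Upper bound: a copy of C₂ₗ₊₁ is determined by a vertex v on it and the edge
-- opposite to v, since two different paths of length ≤ l with the same ends
-- would close up to a cycle of length ≤ 2l.  Fix v.  If more than O(n) edges
-- were opposite to v, they would contain a graph of large minimum degree.
-- Colour its vertices by the first step of their path from v.  A path of length
-- 2(k - l) + 1 in it whose ends have different colours would close up through v
-- to a C₂ₖ₊₁, while ends of the same colour along all such paths contradict
-- that adjacent vertices have different colours.
--
-- Lower bound: starting from the empty graph, add copies of C₂ₗ₊₁ whose
-- vertices are pairwise at distance > 2k + 1 in the graph so far, in d rounds of
-- s = ⌊n / 2(2l + 1)⌋ vertex-disjoint copies each.  Then every cycle of length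
-- ≤ 2k + 1 has length 2l + 1.  Degrees stay O(d), so balls of radius 2k + 1 have
-- O(d^(2k + 1)) vertices, and far apart vertices can be found as long as
-- d^(2k + 1) = O(n).  The choice d = ⌊n^(1/(2k + 2))⌋, for which d·d^(2k + 1) ≤ n
-- absorbs the constants, gives d·s = Ω(n^(1 + 1/(2k + 2))) copies.

open import Defs
open import Data.Nat using (ℕ; zero; suc; _+_; _*_; _∸_; _^_; _≤_; _<_; z≤n; s≤s; s≤s⁻¹)
import Data.Nat as ℕ
import Data.Nat.Properties as ℕₚ
open import Data.Nat.DivMod using (_/_; m/n*n≤m; m≡m%n+[m/n]*n; m%n<n)
open import Data.Nat.Tactic.RingSolver using (solve-∀)
open import Data.Fin using (Fin; zero; suc; toℕ; fromℕ; fromℕ<; inject₁)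
import Data.Fin.Properties as Finₚ
open import Data.Fin.Subset using (Subset) renaming (_∈_ to _∈ˢ_)
open import Data.Fin.Subset.Properties using (⊆-antisym)
open import Data.Vec using (Vec)
import Data.Vec as Vec
import Data.Vec.Properties as Vecₚ
open import Data.List
  using (List; []; _∷_; [_]; _++_; _ʳ++_; map; filter; length; lookup; tabulate; reverse; allFin; applyUpTo; concatMap)
import Data.List.Properties as Listₚ
open import Data.List.Extrema.Nat using (max≤v⁺)
open import Data.List.Membership.Propositional using (_∈_; _∉_; find; lose)
open import Data.List.Membership.Propositional.Properties
import Data.List.Membership.DecPropositional as DecMembership
open import Data.List.Relation.Unary.All as All using (All; []; _∷_)
import Data.List.Relation.Unary.All.Properties as Allₚ
open import Data.List.Relation.Unary.Any as Any using (here; there)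
import Data.List.Relation.Unary.Any.Properties as Anyₚ
open import Data.List.Relation.Unary.AllPairs using ([]; _∷_)
open import Data.List.Relation.Unary.Unique.Propositional using (Unique)
import Data.List.Relation.Unary.Unique.Propositional.Properties as Uniqueₚ
open import Data.List.Relation.Binary.Permutation.Propositional using (_↭_; prep; ↭-sym; ↭-trans; ↭⇒↭ₛ)
import Data.List.Relation.Binary.Permutation.Propositional.Properties as Permₚ
import Data.List.Relation.Binary.Permutation.Setoid.Properties as Permₛ
open import Data.Product using (Σ; ∃; ∃₂; ∃-syntax; _×_; _,_; proj₁; proj₂)
import Data.Product.Properties as Productₚ
open import Data.Sum as Sum using (_⊎_; inj₁; inj₂)
open import Data.Unit using (⊤; tt)
open import Data.Empty using (⊥; ⊥-elim)
open import Function using (_∘_; id; Injective)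
open import Function.Bundles using (_⇔_; mk⇔; Equivalence)
open import Relation.Binary.Definitions using (Decidable; DecidableEquality; Symmetric)
open import Relation.Binary.PropositionalEquality
  using (_≡_; _≢_; refl; sym; trans; cong; cong₂; subst; subst₂; setoid)
open import Relation.Nullary using (¬_; Dec; yes; no; does; ¬?)
open import Relation.Nullary.Decidable using (dec-true; decidable-stable; _×-dec_; _⊎-dec_)
import Relation.Unary as U

private variable
  A B : Set
  x y z : A
  xs ys zs : List A
  R : A → A → Set
  h k l m n : ℕ

-- Lists without repetition, and counting with them.

unique-∉ : Unique (x ∷ xs) → x ∉ xs
unique-∉ = Uniqueₚ.Unique[x∷xs]⇒x∉xs

unique-∷ : x ∉ xs → Unique xs → Unique (x ∷ xs)
unique-∷ x∉ u = Allₚ.¬Any⇒All¬ _ x∉ ∷ u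

unique-tail : Unique (x ∷ xs) → Unique xs
unique-tail (_ ∷ u) = u

unique-resp-↭ : xs ↭ ys → Unique xs → Unique ys
unique-resp-↭ p = Permₛ.Unique-resp-↭ (setoid _) (↭⇒↭ₛ p)

unique-++ : ∀ xs {ys : List A} → Unique (xs ++ ys) →
            Unique xs × Unique ys × (∀ {x} → x ∈ xs → x ∉ ys)
unique-++ []       u = [] , u , λ ()
unique-++ (x ∷ xs) u@(_ ∷ u′) with unique-++ xs u′
... | uxs , uys , d = unique-∷ (unique-∉ u ∘ ∈-++⁺ˡ) uxs , uys ,
      λ { (here refl) → unique-∉ u ∘ ∈-++⁺ʳ xs ; (there x∈) → d x∈ }

unique-⊆-length : {xs ys : List A} → Unique xs → (∀ {x} → x ∈ xs → x ∈ ys) → length xs ≤ length ys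
unique-⊆-length {xs = []} u sub = z≤n
unique-⊆-length {xs = x ∷ xs} u sub with ∈-∃++ (sub (here refl))
... | as , bs , refl = subst (suc (length xs) ≤_) (sym (Permₚ.↭-length (Permₚ.shift x as bs)))
        (s≤s (unique-⊆-length (unique-tail u) λ y∈ →
          strip y∈ (Permₚ.∈-resp-↭ (Permₚ.shift x as bs) (sub (there y∈)))))
  where
  strip : ∀ {y} → y ∈ xs → y ∈ x ∷ (as ++ bs) → y ∈ as ++ bs
  strip y∈ (here refl) = ⊥-elim (unique-∉ u y∈)
  strip y∈ (there y∈′) = y∈′

module _ {A : Set} (_≟_ : DecidableEquality A) {xs : List A} where
  open import Data.List.Membership.DecPropositional _≟_ using (_∈?_)

  exceeding-element : ∀ {ys} → Unique xs → length ys < length xs → ∃[ x ] x ∈ xs × x ∉ ys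
  exceeding-element {ys} u lt with Any.any? (λ x → ¬? (x ∈? ys)) xs
  ... | yes p = find p
  ... | no ¬p = ⊥-elim (ℕₚ.<⇒≱ lt (unique-⊆-length u λ {x} x∈ →
                  decidable-stable (x ∈? ys) (λ x∉ → ¬p (lose x∈ x∉))))

  length-filter-∉ : Unique xs → ∀ ys →
                    length xs ≤ length (filter (λ x → ¬? (x ∈? ys)) xs) + length ys
  length-filter-∉ u ys = ℕₚ.≤-trans (unique-⊆-length u sub) (ℕₚ.≤-reflexive (Listₚ.length-++ (filter _ xs)))
    where
    sub : ∀ {x} → x ∈ xs → x ∈ filter (λ x → ¬? (x ∈? ys)) xs ++ ys
    sub {x} x∈ with x ∈? ys
    ... | yes x∈ys = ∈-++⁺ʳ _ x∈ys
    ... | no x∉ys  = ∈-++⁺ˡ (∈-filter⁺ _ x∈ x∉ys)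

-- Transfers a count along a relation that need not be a function: one related element is chosen for
-- each entry of `xs`, and injectivity keeps the choices distinct.
relabel : (R : A → B → Set) → (∀ {x x′ b} → R x b → R x′ b → x ≡ x′) →
          Unique xs → (∀ {x} → x ∈ xs → ∃ (R x)) →
          ∃[ ys ] Unique ys × length ys ≡ length xs × (∀ {b} → b ∈ ys → ∃[ x ] x ∈ xs × R x b)
relabel {xs = []}     R inj u tot = [] , [] , refl , λ ()
relabel {xs = x ∷ xs} R inj u tot with tot (here refl) | relabel R inj (unique-tail u) (tot ∘ there)
... | b , Rxb | ys , uys , len , src =
  b ∷ ys ,
  unique-∷ (λ b∈ → let (x′ , x′∈ , Rx′b) = src b∈ in
                   unique-∉ u (subst (_∈ xs) (inj Rx′b Rxb) x′∈)) uys ,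
  cong suc len ,
  λ { (here refl) → x , here refl , Rxb
    ; (there b∈) → let (x′ , x′∈ , r) = src b∈ in x′ , there x′∈ , r }

-- Removing vertices of small degree one at a time: an edge set with more than
-- D edges per vertex contains a nonempty edge set of minimum degree > D.
module _ {V E : Set} {Inc : V → E → Set} (inc? : ∀ v e → Dec (Inc v e)) (P : E → Set) (D : ℕ)
         (no-core : ∀ {es} → Unique es → (∀ {e} → e ∈ es → P e) → ∃ (_∈ es) →
                    (∀ {v e} → e ∈ es → Inc v e → D < length (filter (inc? v) es)) → ⊥)
  where

  edges≤degree*vertices : ∀ {es} m vs → length vs ≤ m → Unique es → (∀ {e} → e ∈ es → P e) →
    (∀ {v e} → e ∈ es → Inc v e → v ∈ vs) → length es ≤ m * D
  edges≤degree*vertices {[]}          m vs |vs|≤m u p ends = z≤n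
  edges≤degree*vertices {es@(e₀ ∷ _)} m vs |vs|≤m u p ends
    with Any.any? (λ v → length (filter (inc? v) es) ℕ.≤? D) vs
  ... | no ¬low = ⊥-elim (no-core u p (e₀ , here refl)
                    λ e∈ i → ℕₚ.≰⇒> λ le → ¬low (lose (ends e∈ i) le))
  ... | yes low with find low
  ... | v , v∈ , deg≤ with ∈-∃++ v∈
  -- Recursion is on `m`, since `as ++ bs` is not a subterm of `vs`; when `m` is zero there is no
  -- `v` to remove.
  edges≤degree*vertices {es@(e₀ ∷ _)} zero vs |vs|≤m u p ends
    | yes low | v , v∈ , deg≤ | as , bs , refl =
      ⊥-elim (ℕₚ.<⇒≱ (∈-length v∈) |vs|≤m)
  edges≤degree*vertices {es@(e₀ ∷ _)} (suc m) vs |vs|≤m u p ends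
    | yes low | v , v∈ , deg≤ | as , bs , refl = begin
      length es                                ≤⟨ unique-⊆-length u split ⟩
      length (filter (inc? v) es ++ rest)      ≡⟨ Listₚ.length-++ (filter (inc? v) es) ⟩
      length (filter (inc? v) es) + length rest ≤⟨ ℕₚ.+-mono-≤ deg≤ IH ⟩
      D + m * D                                ∎
    where
    open ℕₚ.≤-Reasoning
    rest = filter (¬? ∘ inc? v) es
    split : ∀ {e} → e ∈ es → e ∈ filter (inc? v) es ++ rest
    split {e} e∈ with inc? v e
    ... | yes i = ∈-++⁺ˡ (∈-filter⁺ (inc? v) e∈ i)
    ... | no ¬i = ∈-++⁺ʳ (filter (inc? v) es) (∈-filter⁺ (¬? ∘ inc? v) e∈ ¬i)
    unrest : ∀ {e} → e ∈ rest → e ∈ es × ¬ Inc v e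
    unrest = ∈-filter⁻ (¬? ∘ inc? v)
    strip : ∀ {w} → w ≢ v → w ∈ v ∷ (as ++ bs) → w ∈ as ++ bs
    strip w≢v (here e)  = ⊥-elim (w≢v e)
    strip w≢v (there i) = i
    IH : length rest ≤ m * D
    IH = edges≤degree*vertices m (as ++ bs)
           (s≤s⁻¹ (subst (_≤ suc m) (Permₚ.↭-length (Permₚ.shift v as bs)) |vs|≤m))
           (Uniqueₚ.filter⁺ (¬? ∘ inc? v) u) (p ∘ proj₁ ∘ unrest)
           λ e∈ i → strip (λ { refl → proj₂ (unrest e∈) i })
                          (Permₚ.∈-resp-↭ (Permₚ.shift v as bs) (ends (proj₁ (unrest e∈)) i))

-- Walks

infixr 5 _∷_

-- The list holds the vertices after the first, so a cycle is a closed walk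
-- with Unique list, and its length is the length of that list.
data Walk {A : Set} (R : A → A → Set) (x : A) : List A → A → Set where
  []  : Walk R x [] x
  _∷_ : ∀ {y z ys} → R x y → Walk R y ys z → Walk R x (y ∷ ys) z

Cycle : (A → A → Set) → A → List A → Set
Cycle R x xs = Walk R x xs x × Unique xs

mapʷ : {R S : A → A → Set} → (∀ {x y} → R x y → S x y) → Walk R x xs y → Walk S x xs y
mapʷ f []      = []
mapʷ f (r ∷ w) = f r ∷ mapʷ f w

_++ʷ_ : Walk R x xs y → Walk R y ys z → Walk R x (xs ++ ys) z
[]      ++ʷ w = w
(r ∷ v) ++ʷ w = r ∷ (v ++ʷ w)

cutʷ : ∀ xs → Walk R x (xs ++ y ∷ ys) z → ∃[ u ] Walk R x xs u × R u y × Walk R y ys z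
cutʷ []       (r ∷ w) = _ , [] , r , w
cutʷ (_ ∷ xs) (r ∷ w) = let (u , v , r′ , w′) = cutʷ xs w in u , r ∷ v , r′ , w′

splitʷ : ∀ xs → Walk R x (xs ++ y ∷ ys) z → Walk R x (xs ++ [ y ]) y × Walk R y ys z
splitʷ xs w = let (_ , v , r , w′) = cutʷ xs w in v ++ʷ (r ∷ []) , w′

end-∈ : Walk R x (z ∷ xs) y → y ∈ z ∷ xs
end-∈ (r ∷ [])       = here refl
end-∈ (r ∷ w@(_ ∷ _)) = there (end-∈ w)

end-unique : Walk R x xs y → Walk R x xs z → y ≡ z
end-unique []      []       = refl
end-unique (_ ∷ v) (_ ∷ w) = end-unique v w

reverseʷ : {R : A → A → Set} → Symmetric R →
           Walk R x xs y → R y z → ∀ {y′} → Walk R x ys y′ → Walk R z (xs ʳ++ (x ∷ ys)) y′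
reverseʷ s []      q w = s q ∷ w
reverseʷ s (r ∷ v) q w = reverseʷ s v q (s r ∷ w)

-- Goes back along the first walk and out along the second. A walk's list omits its start, so the
-- list is described after putting `y` in front.
joinʷ : {R : A → A → Set} → Symmetric R → Walk R x xs y → Walk R x ys z →
        ∃[ zs ] Walk R y zs z × y ∷ zs ≡ xs ʳ++ (x ∷ ys)
joinʷ s []      w = _ , w , refl
joinʷ s (r ∷ v) w = joinʷ s v (s r ∷ w)

tabulateʷ : ∀ (f : Fin (suc m) → A) → (∀ i → R (f (inject₁ i)) (f (suc i))) →
            Walk R (f zero) (tabulate (f ∘ suc)) (f (fromℕ m))
tabulateʷ {m = zero}  f r = []
tabulateʷ {m = suc m} f r = r zero ∷ tabulateʷ (f ∘ suc) (r ∘ suc)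

lookup-step : Walk R x xs y → ∀ i j → suc (toℕ i) ≡ toℕ j → R (lookup xs i) (lookup xs j)
lookup-step (r ∷ (r′ ∷ w)) zero (suc zero) _ = r′
lookup-step (r ∷ w) (suc i) (suc j) e = lookup-step w i j (ℕₚ.suc-injective e)

lookup-first : Walk R x xs y → ∀ i → toℕ i ≡ 0 → R x (lookup xs i)
lookup-first (r ∷ w) zero _ = r

lookup-last : Walk R x xs y → ∀ i → suc (toℕ i) ≡ length xs → lookup xs i ≡ y
lookup-last (r ∷ [])      zero    _ = refl
lookup-last (r ∷ w@(_ ∷ _)) (suc i) e = lookup-last w i (ℕₚ.suc-injective e)

-- A local condition, easy to check where two walks are joined. In the absence of short cycles it
-- already makes a short walk a path, so it can replace `Unique`.
NonBacktracking : List A → Set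
NonBacktracking (x ∷ xs@(y ∷ z ∷ _)) = x ≢ z × NonBacktracking xs
NonBacktracking _                    = ⊤

nb-tail : ∀ (xs : List A) → NonBacktracking (x ∷ xs) → NonBacktracking xs
nb-tail []          _ = tt
nb-tail (_ ∷ [])    _ = tt
nb-tail (_ ∷ _ ∷ _) (_ , nb) = nb

unique⇒nb : Unique xs → NonBacktracking xs
unique⇒nb {xs = []}           _ = tt
unique⇒nb {xs = _ ∷ []}       _ = tt
unique⇒nb {xs = _ ∷ _ ∷ []}   _ = tt
unique⇒nb {xs = _ ∷ _ ∷ _ ∷ _} u@((_ ∷ x≢z ∷ _) ∷ u′) = x≢z , unique⇒nb u′

nb-prefix : ∀ (xs {ys} : List A) → NonBacktracking (xs ++ ys) → NonBacktracking xs
nb-prefix []               _ = tt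
nb-prefix (_ ∷ [])         _ = tt
nb-prefix (_ ∷ _ ∷ [])     _ = tt
nb-prefix (x ∷ y ∷ z ∷ xs) (x≢z , nb) = x≢z , nb-prefix (y ∷ z ∷ xs) nb

nb-join : ∀ x y xs (ys : List A) → NonBacktracking (x ∷ y ∷ xs) → NonBacktracking (y ∷ x ∷ ys) →
          NonBacktracking ((y ∷ xs) ʳ++ (x ∷ ys))
nb-join x y []       ys _          nb = nb
nb-join x y (z ∷ xs) ys (x≢z , nb′) nb = nb-join y z xs (x ∷ ys) nb′ (x≢z ∘ sym , nb)

nb-diverging : ∀ x {y z} (xs ys : List A) → y ≢ z →
               NonBacktracking (x ∷ y ∷ xs) → NonBacktracking (x ∷ z ∷ ys) →
               NonBacktracking ((y ∷ xs) ʳ++ (x ∷ z ∷ ys))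
nb-diverging x {y} {z} xs ys y≢z nb nb′ = nb-join x y xs (z ∷ ys) nb (y≢z , nb′)

-- Short non-backtracking walks in a graph without short cycles.

module Girth {A : Set} (_≟_ : DecidableEquality A) (R : A → A → Set) (s : Symmetric R)
  (irr : ∀ {x} → ¬ R x x) (g : ℕ)
  (no-short-cycle : ∀ {x xs} → Cycle R x xs → 3 ≤ length xs → length xs ≤ g → ⊥) where

  open import Data.List.Membership.DecPropositional _≟_ using (_∈?_)

  -- By induction the tail is a path. A return to `x` would cut off a closed walk without repeated
  -- vertices: length 1 contradicts irreflexivity, length 2 is backtracking, and anything longer is
  -- a short cycle.
  nb-walk-unique : Walk R x xs y → NonBacktracking (x ∷ xs) → length xs ≤ g → Unique (x ∷ xs)
  nb-walk-unique []      _ _ = [] ∷ []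
  nb-walk-unique {x = x} {xs = xs@(_ ∷ xs′)} {y = y} w₀@(r ∷ w) nb len =
    unique-∷ x∉ u
    where
    u : Unique xs
    u = nb-walk-unique w (nb-tail xs nb) (ℕₚ.≤-trans (ℕₚ.n≤1+n _) len)
    closed : ∀ as {bs} → xs ≡ as ++ x ∷ bs → ⊥
    closed as {bs} e = go as e (proj₁ (splitʷ as (subst (λ zs → Walk R x zs y) e w₀)))
                 (proj₁ (unique-++ (as ++ [ x ]) (subst Unique (trans e (sym (Listₚ.++-assoc as [ x ] bs))) u)))
                 (ℕₚ.≤-trans (ℕₚ.≤-trans (ℕₚ.m≤m+n (length (as ++ [ x ])) (length bs))
                   (ℕₚ.≤-reflexive (trans (sym (Listₚ.length-++ (as ++ [ x ])))
                      (cong length (trans (Listₚ.++-assoc as [ x ] bs) (sym e)))))) len)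
      where
      go : ∀ as → xs ≡ as ++ x ∷ bs → Walk R x (as ++ [ x ]) x → Unique (as ++ [ x ]) →
           length (as ++ [ x ]) ≤ g → ⊥
      go []           _    (r ∷ []) _ _ = irr r
      go (_ ∷ [])     refl _        _ _ = proj₁ nb refl
      go (_ ∷ _ ∷ as) _    w        u l = no-short-cycle (w , u)
        (s≤s (s≤s (subst (1 ≤_) (sym (Listₚ.length-++ as)) (ℕₚ.m≤n+m 1 (length as))))) l
    x∉ : x ∉ xs
    x∉ x∈ = let (as , bs , e) = ∈-∃++ x∈ in closed as e

  closed-nb-walk-trivial : Walk R x (z ∷ xs) x → NonBacktracking (x ∷ z ∷ xs) →
                           length (z ∷ xs) ≤ g → ⊥
  closed-nb-walk-trivial w nb len = unique-∉ (nb-walk-unique w nb len) (end-∈ w)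

  private
    ≤-drop : ∀ {a b} → suc a + suc b ≤ g → a + b ≤ g
    ≤-drop {a} {b} le = ℕₚ.≤-trans (ℕₚ.+-mono-≤ (ℕₚ.n≤1+n a) (ℕₚ.n≤1+n b)) le

  -- Going back to `v` and out again does not backtrack at `v` because `a` and `b` differ, so the
  -- joined walk falls under `nb-walk-unique`.
  diverging-unique : ∀ {a b as bs v} → a ≢ b →
    Walk R v (a ∷ as) x → NonBacktracking (v ∷ a ∷ as) →
    Walk R v (b ∷ bs) y → NonBacktracking (v ∷ b ∷ bs) →
    length (a ∷ as) + length (b ∷ bs) ≤ g →
    ∃[ zs ] Walk R x zs y × Unique (x ∷ zs) × x ∷ zs ≡ (a ∷ as) ʳ++ (v ∷ b ∷ bs)
      × length zs ≡ length (a ∷ as) + length (b ∷ bs)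
  diverging-unique {x = x} {a = a} {b} {as} {bs} {v} a≢b p nbp q nbq len with joinʷ s p q
  ... | zs , w , e = zs , w ,
        nb-walk-unique w (subst NonBacktracking (sym e) (nb-diverging v as bs a≢b nbp nbq))
          (subst (_≤ g) (sym |zs|) len) , e , |zs|
    where
    |zs| : length zs ≡ length (a ∷ as) + length (b ∷ bs)
    |zs| = ℕₚ.suc-injective (trans (cong length e)
             (trans (Listₚ.length-ʳ++ (a ∷ as)) (ℕₚ.+-suc (length (a ∷ as)) _)))

  -- Common first steps are stripped. Where the walks diverge, joining them would give a path of
  -- positive length from `x` to `x`.
  nb-walk-determined : ∀ {v ps qs} → Walk R v ps x → NonBacktracking (v ∷ ps) →
    Walk R v qs x → NonBacktracking (v ∷ qs) → length ps + length qs ≤ g → ps ≡ qs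
  nb-walk-determined {ps = []}     {[]}     _  _   _  _   _   = refl
  nb-walk-determined {ps = []}     {_ ∷ qs} [] _   w  nb  len = ⊥-elim (closed-nb-walk-trivial w nb len)
  nb-walk-determined {ps = _ ∷ ps} {[]}     w  nb  [] _   len =
    ⊥-elim (closed-nb-walk-trivial w nb (subst (_≤ g) (ℕₚ.+-identityʳ _) len))
  nb-walk-determined {x = x} {ps = a ∷ ps} {b ∷ qs} (r ∷ p) nbp (r′ ∷ q) nbq len with a ≟ b
  ... | yes refl = cong (a ∷_)
          (nb-walk-determined p (nb-tail (a ∷ ps) nbp) q (nb-tail (a ∷ qs) nbq) (≤-drop len))
  ... | no a≢b with diverging-unique a≢b (r ∷ p) nbp (r′ ∷ q) nbq len
  ...   | []     , _ , _ , _ , ()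
  ...   | _ ∷ zs , w , u , _ , _ = ⊥-elim (unique-∉ u (end-∈ w))

-- Copies of graphs and of cycles

fromPredicate : {P : Fin n → Set} → U.Decidable P → Subset n
fromPredicate P? = Vec.tabulate (does ∘ P?)

module _ {P : Fin n → Set} (P? : U.Decidable P) where
  fromPredicate⁺ : ∀ {i} → P i → i ∈ˢ fromPredicate P?
  fromPredicate⁺ {i} p = Vecₚ.lookup⇒[]= i _ (trans (Vecₚ.lookup∘tabulate _ i) (dec-true (P? i) p))

  fromPredicate⁻ : ∀ {i} → i ∈ˢ fromPredicate P? → P i
  fromPredicate⁻ {i} i∈ with P? i | trans (sym (Vecₚ.lookup∘tabulate (does ∘ P?) i)) (Vecₚ.[]=⇒lookup i∈)
  ... | yes p | _ = p
  ... | no _  | ()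

vec-ext : {A : Set} {u v : Vec A n} → (∀ i → Vec.lookup u i ≡ Vec.lookup v i) → u ≡ v
vec-ext {u = u} {v} e = trans (sym (Vecₚ.tabulate∘lookup u))
                          (trans (Vecₚ.tabulate-cong e) (Vecₚ.tabulate∘lookup v))

subset-ext : {p q : Subset n} → (∀ i → i ∈ˢ p ⇔ i ∈ˢ q) → p ≡ q
subset-ext e = ⊆-antisym (λ {i} → Equivalence.to (e i)) (λ {i} → Equivalence.from (e i))

module _ (H : Graph h) (f : Fin h → Fin n) where

  ImageAdj : Fin n → Fin n → Set
  ImageAdj i j = ∃₂ λ x y → f x ≡ i × f y ≡ j × Adj H x y

  imageAdj? : Decidable ImageAdj
  imageAdj? i j = Finₚ.any? λ x → Finₚ.any? λ y → (f x Finₚ.≟ i) ×-dec (f y Finₚ.≟ j) ×-dec adj? H x y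

  imageAdj-sym : Symmetric ImageAdj
  imageAdj-sym (x , y , fx , fy , a) = y , x , fy , fx , symm H a

  private
    inImage? : U.Decidable (λ i → ∃[ x ] f x ≡ i)
    inImage? i = Finₚ.any? λ x → f x Finₚ.≟ i

  image : SubgraphData n
  image = fromPredicate inImage? , Vec.tabulate λ i → fromPredicate (imageAdj? i)

  image-edge⁺ : ∀ {i j} → ImageAdj i j → Edge image i j
  image-edge⁺ {i} {j} a = subst (j ∈ˢ_) (sym (Vecₚ.lookup∘tabulate _ i)) (fromPredicate⁺ (imageAdj? i) a)

  image-edge⁻ : ∀ {i j} → Edge image i j → ImageAdj i j
  image-edge⁻ {i} {j} e = fromPredicate⁻ (imageAdj? i) (subst (j ∈ˢ_) (Vecₚ.lookup∘tabulate _ i) e)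

  image-isSubgraph : (G : Graph n) → (∀ {i j} → ImageAdj i j → Adj G i j) → IsSubgraph G image
  image-isSubgraph G sub = record
    { edge-sym  = λ i j → image-edge⁺ ∘ imageAdj-sym ∘ image-edge⁻
    ; edge-ends = λ i j e → let (x , _ , fx , _) = image-edge⁻ e in fromPredicate⁺ inImage? (x , fx)
    ; edge-sub  = λ i j → sub ∘ image-edge⁻
    }

  image-isIsomorphism : Injective _≡_ _≡_ f → IsIsomorphism H image f
  image-isIsomorphism inj = record
    { injective = inj
    ; into      = λ x → fromPredicate⁺ inImage? (x , refl)
    ; onto      = λ i → fromPredicate⁻ inImage?
    ; edges     = λ x y → mk⇔ (λ a → image-edge⁺ (x , y , refl , refl , a))
        (λ e → let (_ , _ , fx , fy , a) = image-edge⁻ e in subst₂ (Adj H) (inj fx) (inj fy) a)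
    }

  image-isCopy : (G : Graph n) → Injective _≡_ _≡_ f → (∀ {x y} → Adj H x y → Adj G (f x) (f y)) →
                 IsCopy H G image
  image-isCopy G inj hom =
    image-isSubgraph G (λ (_ , _ , fx , fy , a) → subst₂ (Adj G) fx fy (hom a)) , f , image-isIsomorphism inj

module _ {H : Graph h} {G : Graph n} {f : Fin h → Fin n} where

  private
    vertex-transfer : ∀ {S S′ i} → IsIsomorphism H S f → IsIsomorphism H S′ f → Vertex S i → Vertex S′ i
    vertex-transfer {S′ = S′} iso iso′ v =
      let (x , e) = IsIsomorphism.onto iso _ v in subst (Vertex S′) e (IsIsomorphism.into iso′ x)

    edge-transfer : ∀ {S S′ i j} → IsSubgraph G S → IsIsomorphism H S f → IsIsomorphism H S′ f →
                    Edge S i j → Edge S′ i j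
    edge-transfer {S} {S′} sub iso iso′ e =
      let (x , fx) = IsIsomorphism.onto iso _ (IsSubgraph.edge-ends sub _ _ e)
          (y , fy) = IsIsomorphism.onto iso _ (IsSubgraph.edge-ends sub _ _ (IsSubgraph.edge-sym sub _ _ e))
      in subst₂ (Edge S′) fx fy (Equivalence.to (IsIsomorphism.edges iso′ x y)
           (Equivalence.from (IsIsomorphism.edges iso x y) (subst₂ (Edge S) (sym fx) (sym fy) e)))

  -- `onto` makes the vertex set the image of `f`; `edge-ends` and `edge-sym` place both ends of
  -- every edge in it, so `f` carries over the edges too.
  copy-determined : ∀ {S S′} → IsSubgraph G S → IsSubgraph G S′ →
                    IsIsomorphism H S f → IsIsomorphism H S′ f → S ≡ S′
  copy-determined {V , E} {V′ , E′} sub sub′ iso iso′ = cong₂ _,_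
    (subset-ext λ i → mk⇔ (vertex-transfer {S = V , E} {V′ , E′} iso iso′) (vertex-transfer {S = V′ , E′} {V , E} iso′ iso))
    (vec-ext λ i → subset-ext λ j → mk⇔ (edge-transfer {V , E} {V′ , E′} sub iso iso′)
                                        (edge-transfer {V′ , E′} {V , E} sub′ iso′ iso))

iso-hom : {H : Graph h} {G : Graph n} {S : SubgraphData n} {f : Fin h → Fin n} →
          IsSubgraph G S → IsIsomorphism H S f → ∀ {x y} → Adj H x y → Adj G (f x) (f y)
iso-hom sub iso {x} {y} a =
  IsSubgraph.edge-sub sub _ _ (Equivalence.to (IsIsomorphism.edges iso x y) a)

C-step : ∀ (i : Fin m) → Adj (C (suc m)) (inject₁ i) (suc i)
C-step {m} i = (λ e → ℕₚ.1+n≢n (sym (trans (sym (Finₚ.toℕ-inject₁ i)) (cong toℕ e)))) ,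
           inj₁ (inj₁ (cong suc (Finₚ.toℕ-inject₁ i)))

C-close : 1 ≤ m → Adj (C (suc m)) (fromℕ m) zero
C-close {suc m} _ = (λ ()) , inj₁ (inj₂ (cong suc (Finₚ.toℕ-fromℕ (suc m)) , refl))

module _ {G : Graph n} {f : Fin (suc m) → Fin n}
         (hom : ∀ {x y} → Adj (C (suc m)) x y → Adj G (f x) (f y)) where

  hom-walk : Walk (Adj G) (f zero) (tabulate (f ∘ suc)) (f (fromℕ m))
  hom-walk = tabulateʷ f (λ i → hom (C-step i))

  -- Based at the last vertex, so that the list of the closed walk is exactly `tabulate f`.
  hom-closed : 1 ≤ m → Walk (Adj G) (f (fromℕ m)) (tabulate f) (f (fromℕ m))
  hom-closed m≥1 = hom (C-close m≥1) ∷ hom-walk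

contains⇒cycle : {G : Graph n} → 1 ≤ m → Contains G (C (suc m)) →
                 ∃₂ λ x xs → Cycle (Adj G) x xs × length xs ≡ suc m
contains⇒cycle {G = G} m≥1 (S , sub , f , iso) =
  _ , tabulate f ,
  (hom-closed {G = G} {f} (iso-hom {G = G} sub iso) m≥1 , Uniqueₚ.tabulate⁺ (IsIsomorphism.injective iso)) ,
  Listₚ.length-tabulate f

lookup-injective : {A : Set} {xs : List A} → Unique xs → ∀ {i j} → lookup xs i ≡ lookup xs j → i ≡ j
lookup-injective {xs = _ ∷ xs} u       {zero}  {zero}  e = refl
lookup-injective {xs = _ ∷ xs} u       {zero}  {suc j} e = ⊥-elim (unique-∉ u (subst (_∈ xs) (sym e) (∈-lookup j)))
lookup-injective {xs = _ ∷ xs} u       {suc i} {zero}  e = ⊥-elim (unique-∉ u (subst (_∈ xs) e (∈-lookup i)))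
lookup-injective {xs = _ ∷ xs} (_ ∷ u) {suc i} {suc j} e = cong suc (lookup-injective u e)

cycle⇒contains : {G : Graph n} → ∀ {x xs} → Cycle (Adj G) x xs → Contains G (C (length xs))
cycle⇒contains {G = G} {x} {xs} (w , u) =
  _ , image-isCopy (C (length xs)) (lookup xs) G (lookup-injective u) hom
  where
  next : ∀ {i j} → Next (length xs) i j → Adj G (lookup xs i) (lookup xs j)
  next (inj₁ e)        = lookup-step w _ _ e
  -- The closing edge leaves the last entry of `xs`, which is the base point `x`.
  next (inj₂ (e , e₀)) = subst (λ v → Adj G v _) (sym (lookup-last w _ e)) (lookup-first w _ e₀)
  hom : ∀ {i j} → Adj (C (length xs)) i j → Adj G (lookup xs i) (lookup xs j)
  hom (_ , inj₁ s) = next s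
  hom (_ , inj₂ s) = symm G (next s)

-- The upper bound

module Greedy {A : Set} (E : A → A → Set) (I : A → Set) (b : ℕ)
  (extend : ∀ {x} → I x → (Z : List A) → length Z ≤ b → ∃[ y ] y ∉ Z × E x y × I y) where

  -- Greedy: every visited vertex joins the set to avoid, so `length Z + m` stays constant.
  path-avoiding : ∀ m {x} → I x → (Z : List A) → length Z + m ≤ b →
    ∃₂ λ xs y → Walk E x xs y × length xs ≡ m × Unique (x ∷ xs) × (∀ {z} → z ∈ Z → z ∉ xs) × I y
  path-avoiding zero    {x} ix Z le = [] , x , [] , refl , [] ∷ [] , (λ _ ()) , ix
  path-avoiding (suc m) {x} ix Z le
    with extend ix (x ∷ Z) (ℕₚ.≤-trans (s≤s (ℕₚ.m≤m+n _ m)) (subst (_≤ b) (ℕₚ.+-suc _ m) le))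
  ... | y , y∉ , e , iy with path-avoiding m iy (x ∷ Z) (subst (_≤ b) (ℕₚ.+-suc _ m) le)
  ... | xs , z , w , len , u , avoid , iz =
    y ∷ xs , z , e ∷ w , cong suc len ,
    unique-∷ (λ { (here refl) → y∉ (here refl) ; (there x∈) → avoid (here refl) x∈ }) u ,
    (λ { z∈ (here refl) → y∉ (there z∈) ; z∈ (there i) → avoid (there z∈) i }) , iz

-- If every path of length 2q + 1 has ends of the same colour, then all
-- neighbours of a vertex have the same colour; hence so do the ends of an even
-- walk, and removing the first edge of a path of length 2q + 1 gives two
-- adjacent vertices of the same colour.
module Colouring {A K : Set} (E : A → A → Set) (symE : Symmetric E) (irrE : ∀ {x} → ¬ E x x)
  (I : A → Set) (q : ℕ)
  (extend : ∀ {x} → I x → (Z : List A) → length Z ≤ 2 + q * 2 → ∃[ y ] y ∉ Z × E x y × I y)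
  (incident : ∀ {x y} → E x y → I y)
  (Col : A → K → Set) (colour : ∀ {x} → I x → ∃ (Col x))
  (functional : ∀ {x c d} → Col x c → Col x d → c ≡ d)
  (proper : ∀ {x y c} → E x y → Col x c → Col y c → ⊥)
  (ends : ∀ {x y xs c d} → Walk E x xs y → Unique (x ∷ xs) → length xs ≡ suc (q * 2) →
          Col x c → Col y d → c ≡ d) where

  open Greedy E I (2 + q * 2) extend

  -- A path of length `q * 2` from `x` avoiding `y` and `z` becomes one of length `suc (q * 2)` when
  -- either is put in front, so both have the colour of its end `t`. The two avoided vertices
  -- explain the `2 +` in the bound of `extend`.
  neighbours-same : ∀ {x y z c d} → E x y → E x z → Col y c → Col z d → c ≡ d
  neighbours-same {x} {y} {z} exy exz cy dz
    with path-avoiding (q * 2) (incident (symE exy)) (y ∷ z ∷ []) ℕₚ.≤-refl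
  ... | xs , t , w , len , u , avoid , it with colour it
  ... | _ , ct = trans (via (here refl) exy cy) (sym (via (there (here refl)) exz dz))
    where
    via : ∀ {y′ c} → y′ ∈ y ∷ z ∷ [] → E x y′ → Col y′ c → c ≡ _
    via y∈ e c = ends (symE e ∷ w)
      (unique-∷ (λ { (here refl) → irrE e ; (there i) → avoid y∈ i }) u) (cong suc len) c ct

  even-walk-ends : ∀ r {x y xs c d} → Walk E x xs y → length xs ≡ r * 2 → Col x c → Col y d → c ≡ d
  even-walk-ends zero    []            _   cx cy = functional cx cy
  even-walk-ends (suc r) (e ∷ (e′ ∷ w)) len cx cy with colour (incident e′)
  ... | _ , cz = trans (neighbours-same (symE e) e′ cx cz)
                       (even-walk-ends r w (ℕₚ.suc-injective (ℕₚ.suc-injective len)) cz cy)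

  no-min-degree : ∀ {x} → I x → ⊥
  no-min-degree ix with path-avoiding (suc (q * 2)) ix [] (ℕₚ.n≤1+n _)
  ... | y ∷ xs , z , w@(e ∷ w′) , len , u , _ , iz
    with colour ix | colour (incident e) | colour iz
  ... | c , cx | d , cy | d′ , cz = proper e cx (subst (Col y) (sym c≡d) cy)
    where
    c≡d : c ≡ d
    c≡d = trans (ends w u len cx cz) (sym (even-walk-ends q w′ (ℕₚ.suc-injective len) cy cz))

module Upper (G : Graph n) (l q : ℕ)
  (no-short-cycle : ∀ {x xs} → Cycle (Adj G) x xs → 3 ≤ length xs → length xs ≤ l + l → ⊥)
  (no-long-cycle : ∀ {x xs} → Cycle (Adj G) x xs → length xs ≡ l + l + suc (q * 2) → ⊥) where

  open Girth Finₚ._≟_ (Adj G) (symm G) (λ {x} → irrefl G x) (l + l) no-short-cycle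

  private V = Fin n

  -- `a` is the colour of `x` as seen from `v`. By `Girth` the walk is a path and is determined by
  -- its ends.
  Arm : V → V → V → Set
  Arm v a x = ∃[ as ] Walk (Adj G) v (a ∷ as) x × NonBacktracking (v ∷ a ∷ as) × length (a ∷ as) ≡ l

  -- {x, y} is the edge opposite to v in a cycle of length 2l + 1.
  Opposite : V × V × V → Set
  Opposite (v , x , y) = Adj G x y × ∃₂ λ a b → a ≢ b × Arm v a x × Arm v b y

  arm-functional : ∀ {v a b x} → Arm v a x → Arm v b x → a ≡ b
  arm-functional (as , w , nb , len) (bs , w′ , nb′ , len′) =
    Listₚ.∷-injectiveˡ (nb-walk-determined w nb w′ nb′ (ℕₚ.≤-reflexive (cong₂ _+_ len len′)))

  -- The part of the arm up to `u` and the arm ending at `u` have the same ends and total length at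
  -- most `l + l`, so they coincide. That part therefore already has length `l`.
  on-arm⇒end : ∀ {v a as x b u} → Walk (Adj G) v (a ∷ as) x → NonBacktracking (v ∷ a ∷ as) →
               length (a ∷ as) ≡ l → u ∈ a ∷ as → Arm v b u → u ≡ x
  on-arm⇒end {v} {a} {as} {x} {u = u} w nb len u∈ (bs , w′ , nb′ , len′) with ∈-∃++ u∈
  ... | cs , ds , e with splitʷ cs (subst (λ zs → Walk (Adj G) v zs x) e w)
  ... | pre , post = finish ds (trans (Listₚ.++-assoc cs [ u ] ds) (sym e)) post
    where
    |as| : length (cs ++ [ u ]) + length ds ≡ l
    |as| = trans (sym (Listₚ.length-++ (cs ++ [ u ]))) (trans (cong length (trans (Listₚ.++-assoc cs [ u ] ds) (sym e))) len)
    |pre| : length (cs ++ [ u ]) ≡ l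
    |pre| = trans (cong length (nb-walk-determined pre
        (nb-prefix (v ∷ cs ++ [ u ]) (subst (λ zs → NonBacktracking (v ∷ zs)) (trans e (sym (Listₚ.++-assoc cs [ u ] ds))) nb))
        w′ nb′ (ℕₚ.+-mono-≤ (ℕₚ.≤-trans (ℕₚ.m≤m+n _ (length ds)) (ℕₚ.≤-reflexive |as|)) (ℕₚ.≤-reflexive len′)))) len′
    finish : ∀ ds → (cs ++ [ u ]) ++ ds ≡ a ∷ as → Walk (Adj G) u ds x → u ≡ x
    finish []       _ []  = refl
    finish (d ∷ ds) e′ _ = ⊥-elim (ℕₚ.m+1+n≢m l (trans (cong (_+ suc (length ds)) (sym |pre|))
      (trans (sym (Listₚ.length-++ (cs ++ [ u ]))) (trans (cong length e′) len))))

  -- An arm contains no end of another arm except its own, so the path meets the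
  -- two arms only in x and y.
  arms-and-path : ∀ {v a b x y xs} → a ≢ b → Arm v a x → Arm v b y →
    Walk (Adj G) x xs y → Unique (x ∷ xs) → (∀ {u} → u ∈ xs → ∃ λ c → Arm v c u) →
    length xs ≡ suc (q * 2) → ⊥
  arms-and-path {v} {a} {b} {x} {y} {xs} a≢b (as , p , nbp , lenp) (bs , r , nbr , lenr) w u arms len
    with diverging-unique (a≢b ∘ sym) r nbr p nbp (ℕₚ.≤-reflexive (cong₂ _+_ lenr lenp))
  ... | zs , t , ut , e , |zs| =
    -- From `y` back to `v`, out to `x`, and along the given path to `y` again.
    no-long-cycle (t ++ʷ w , Uniqueₚ.++⁺ (unique-tail ut) (unique-tail u) disjoint)
      (trans (Listₚ.length-++ zs) (cong₂ _+_ (trans |zs| (cong₂ _+_ lenr lenp)) len))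
    where
    disjoint : ∀ {c} → c ∈ zs × c ∈ xs → ⊥
    disjoint {c} (c∈zs , c∈xs) with arms c∈xs
    ... | d , arm@(ds , wd , nbd , lend)
      with Anyₚ.reverseAcc⁻ (v ∷ a ∷ as) (b ∷ bs) (subst (c ∈_) e (there c∈zs))
    -- `c` is `v`, or on the arm to `x`, or on the arm to `y`. The first would give a closed arm;
    -- the others force `c` to be `x` or `y`, repeating a vertex of one of the two paths.
    ...   | inj₁ (here refl) = closed-nb-walk-trivial wd nbd (subst (_≤ l + l) (sym lend) (ℕₚ.m≤m+n l l))
    ...   | inj₁ (there c∈) = unique-∉ u (subst (_∈ xs) (on-arm⇒end p nbp lenp c∈ arm) c∈xs)
    ...   | inj₂ c∈ = unique-∉ ut (subst (_∈ zs) (on-arm⇒end r nbr lenr c∈ arm) c∈zs)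

  -- Opposite edges are ordered triples, so each of up to `2 + q * 2` vertices to avoid spoils two
  -- of them.
  D : ℕ
  D = (2 + q * 2) + (2 + q * 2)

  _≟³_ : DecidableEquality (V × V × V)
  _≟³_ = Productₚ.≡-dec Finₚ._≟_ (Productₚ.≡-dec Finₚ._≟_ Finₚ._≟_)

  Ends : V → V × V × V → Set
  Ends z (_ , x , y) = x ≡ z ⊎ y ≡ z

  ends? : ∀ z t → Dec (Ends z t)
  ends? z (_ , x , y) = (x Finₚ.≟ z) ⊎-dec (y Finₚ.≟ z)

  module Core (v : V) {es : List (V × V × V)} (unique : Unique es)
    (opp : ∀ {t} → t ∈ es → Opposite t × proj₁ t ≡ v)
    (deg : ∀ {z t} → t ∈ es → Ends z t → D < length (filter (ends? z) es)) where

    E : V → V → Set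
    E x y = (v , x , y) ∈ es ⊎ (v , y , x) ∈ es

    I : V → Set
    I x = ∃[ y ] E x y

    extend : ∀ {x} → I x → (Z : List V) → length Z ≤ 2 + q * 2 → ∃[ y ] y ∉ Z × E x y × I y
    extend {x} (_ , ex) Z |Z| with exceeding-element _≟³_ {ys = bad} (Uniqueₚ.filter⁺ (ends? x) unique) few
      where
      bad = map (λ z → v , x , z) Z ++ map (λ z → v , z , x) Z
      big : E x _ → D < length (filter (ends? x) es)
      big (inj₁ i) = deg i (inj₁ refl)
      big (inj₂ i) = deg i (inj₂ refl)
      few : length bad < length (filter (ends? x) es)
      few = ℕₚ.≤-<-trans (ℕₚ.≤-trans (ℕₚ.≤-reflexive
              (trans (Listₚ.length-++ (map _ Z)) (cong₂ _+_ (Listₚ.length-map _ Z) (Listₚ.length-map _ Z))))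
              (ℕₚ.+-mono-≤ |Z| |Z|)) (big ex)
    ... | (u , y , z) , t∈ , t∉ with ∈-filter⁻ (ends? x) {xs = es} t∈
    ...   | t∈es , end with proj₂ (opp t∈es)
    extend {x} (_ , ex) Z |Z| | (u , y , z) , t∈ , t∉ | t∈es , inj₁ refl | refl =
      z , (λ z∈ → t∉ (∈-++⁺ˡ (∈-map⁺ _ z∈))) , inj₁ t∈es , x , inj₂ t∈es
    extend {x} (_ , ex) Z |Z| | (u , y , z) , t∈ , t∉ | t∈es , inj₂ refl | refl =
      y , (λ y∈ → t∉ (∈-++⁺ʳ (map _ Z) (∈-map⁺ _ y∈))) , inj₂ t∈es , x , inj₁ t∈es

    edge : ∀ {x y} → E x y → Adj G x y × ∃₂ λ a b → a ≢ b × Arm v a x × Arm v b y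
    edge (inj₁ i) = proj₁ (opp i)
    edge (inj₂ i) = let (e , a , b , a≢b , α , β) = proj₁ (opp i) in symm G e , b , a , a≢b ∘ sym , β , α

    arm : ∀ {x} → I x → ∃ λ a → Arm v a x
    arm (_ , e) = let (_ , a , _ , _ , α , _) = edge e in a , α

    walk-arms : ∀ {x xs y u} → Walk E x xs y → u ∈ xs → ∃ λ a → Arm v a u
    walk-arms (e ∷ w) (here refl) = arm (_ , Sum.swap e)
    walk-arms (e ∷ w) (there u∈)  = walk-arms w u∈

    irreflexive : ∀ {x} → ¬ E x x
    irreflexive {x} e = irrefl G x (proj₁ (edge e))

    proper : ∀ {x y c} → E x y → Arm v c x → Arm v c y → ⊥
    proper e α β = let (_ , _ , _ , a≢b , α′ , β′) = edge e
                   in a≢b (trans (arm-functional α′ α) (arm-functional β β′))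

    path-ends : ∀ {x y xs c d} → Walk E x xs y → Unique (x ∷ xs) → length xs ≡ suc (q * 2) →
                Arm v c x → Arm v d y → c ≡ d
    path-ends {c = c} {d} w u len α β = decidable-stable (c Finₚ.≟ d) λ c≢d →
      arms-and-path c≢d α β (mapʷ (proj₁ ∘ edge) w) u (walk-arms w) len

    incident : ∀ {x y} → E x y → I y
    incident e = _ , Sum.swap e

    Colour : V → V → Set
    Colour x a = Arm v a x

    open Colouring E Sum.swap irreflexive I q extend incident Colour arm arm-functional proper path-ends

    no-core : ∀ {t} → t ∈ es → ⊥
    no-core {_ , x , y} t∈ with proj₂ (opp t∈)
    ... | refl = no-min-degree {x} (y , inj₁ t∈)

  opposite-edges : ∀ v {es} → Unique es → (∀ {t} → t ∈ es → Opposite t × proj₁ t ≡ v) → length es ≤ n * D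
  opposite-edges v u opp = edges≤degree*vertices ends? _ D
    (λ u p (_ , t∈) deg → Core.no-core v u p deg t∈)
    n (allFin n) (ℕₚ.≤-reflexive (Listₚ.length-tabulate id)) u opp (λ _ _ → ∈-allFin _)

  -- The pruning bound again, with a triple incident to its first coordinate only: a core would give
  -- some vertex more than `n * D` opposite edges.
  opposite-triples : ∀ {es} → Unique es → (∀ {t} → t ∈ es → Opposite t) → length es ≤ n * (n * D)
  opposite-triples u opp = edges≤degree*vertices first? Opposite (n * D)
    (λ { u p (t , t∈) deg → ℕₚ.<⇒≱ (deg t∈ refl) (opposite-edges (proj₁ t) (Uniqueₚ.filter⁺ (first? _) u)
           λ s∈ → let (s∈′ , e) = ∈-filter⁻ (first? _) s∈ in p s∈′ , e) })
    n (allFin n) (ℕₚ.≤-reflexive (Listₚ.length-tabulate id)) u opp (λ _ _ → ∈-allFin _)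
    where
    first? : ∀ z (t : V × V × V) → Dec (proj₁ t ≡ z)
    first? z t = proj₁ t Finₚ.≟ z

-- Counting copies by a vertex and its opposite edge.

split-length : ∀ (xs : List A) a {b} → length xs ≡ a + b →
               ∃₂ λ ys zs → ys ++ zs ≡ xs × length ys ≡ a × length zs ≡ b
split-length xs       zero    e = [] , xs , refl , refl , e
split-length (x ∷ xs) (suc a) e = let (ys , zs , e₁ , e₂ , e₃) = split-length xs a (ℕₚ.suc-injective e)
                                  in x ∷ ys , zs , cong (x ∷_) e₁ , cong suc e₂ , e₃

tabulate-injective : {f g : Fin h → A} → tabulate f ≡ tabulate g → ∀ i → f i ≡ g i
tabulate-injective e zero    = Listₚ.∷-injectiveˡ e
tabulate-injective e (suc i) = tabulate-injective (Listₚ.∷-injectiveʳ e) i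

length-filter-≤ : {P : A → Set} (P? : U.Decidable P) {xs : List A} {b : ℕ} → Unique xs →
  (∀ {ys} → Unique ys → (∀ {y} → y ∈ ys → P y) → length ys ≤ b) → length (filter P? xs) ≤ b
length-filter-≤ P? {xs} u bound = bound (Uniqueₚ.filter⁺ P? u) (proj₂ ∘ ∈-filter⁻ P? {xs = xs})

module CopyCount (G : Graph n) (l q : ℕ) (l≥1 : 1 ≤ l)
  (no-short-cycle : ∀ {x xs} → Cycle (Adj G) x xs → 3 ≤ length xs → length xs ≤ l + l → ⊥)
  (no-long-cycle : ∀ {x xs} → Cycle (Adj G) x xs → length xs ≡ l + l + suc (q * 2) → ⊥) where

  open Upper G l q no-short-cycle no-long-cycle
  open Girth Finₚ._≟_ (Adj G) (symm G) (λ {x} → irrefl G x) (l + l) no-short-cycle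

  -- The copy is the cycle consisting of v, the arm P to x, and the reversal of the arm Q to y.
  Codes : SubgraphData n → Fin n × Fin n × Fin n → Set
  Codes S (v , x , y) = IsSubgraph G S × Opposite (v , x , y) ×
    ∃[ f ] IsIsomorphism (C (suc (l + l))) S f × ∃₂ λ P Q → v ∷ (P ++ reverse Q) ≡ tabulate f ×
      (Walk (Adj G) v P x × NonBacktracking (v ∷ P) × length P ≡ l) ×
      (Walk (Adj G) v Q y × NonBacktracking (v ∷ Q) × length Q ≡ l)

  -- Arms are determined by their ends, so the triple recovers `P` and `Q`, hence `f`, hence the
  -- copy. A copy has several codes, of which `relabel` picks one.
  codes-injective : ∀ {S S′ t} → Codes S t → Codes S′ t → S ≡ S′
  codes-injective {S} {S′} (sub , _ , f , iso , P , Q , e , (wp , np , lp) , (wq , nq , lq))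
                  (sub′ , _ , f′ , iso′ , P′ , Q′ , e′ , (wp′ , np′ , lp′) , (wq′ , nq′ , lq′))
    with nb-walk-determined wp np wp′ np′ (ℕₚ.≤-reflexive (cong₂ _+_ lp lp′))
       | nb-walk-determined wq nq wq′ nq′ (ℕₚ.≤-reflexive (cong₂ _+_ lq lq′))
  ... | refl | refl = copy-determined {H = C (suc (l + l))} {G} sub sub′
      (isIsomorphism-resp {H = C (suc (l + l))} {S} (tabulate-injective (trans (sym e) e′)) iso) iso′

  first-step : ∀ {v y} Q → Walk (Adj G) v Q y → NonBacktracking (v ∷ Q) → length Q ≡ l →
               ∃[ b ] b ∈ Q × Arm v b y
  first-step []      w nb len = ⊥-elim (ℕₚ.<⇒≢ l≥1 len)
  first-step (b ∷ Q) w nb len = b , here refl , Q , w , nb , len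

  -- With `f zero` as `v`, the next `l` vertices form one arm, and the last `l`, traversed backwards
  -- from `v`, form the other.
  codes-cycle : ∀ {S f P y Q x w} → IsSubgraph G S → IsIsomorphism (C (suc (l + l))) S f →
    P ++ (y ∷ Q) ≡ tabulate (f ∘ suc) → Unique (tabulate f) → length P ≡ l → length (y ∷ Q) ≡ l →
    Walk (Adj G) (f zero) P x → Adj G x y → Walk (Adj G) y Q w → Adj G w (f zero) →
    Codes S (f zero , x , y)
  codes-cycle {S} {f} {P} {y} {Q} sub iso e uf |P| |Q| p r w close =
    sub , (r , a , b , a≢b , α , β) , f , iso , P , Q′ ,
    cong (f zero ∷_) (trans (cong (P ++_) (Listₚ.reverse-involutive (y ∷ Q))) e) ,
    (p , nbP , |P|) , (q′ , nbQ , |Q′|)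
    where
    Q′ = reverse (y ∷ Q)
    q′ : Walk (Adj G) (f zero) Q′ y
    q′ = reverseʷ (symm G) w close []
    |Q′| : length Q′ ≡ l
    |Q′| = trans (Listₚ.length-reverse (y ∷ Q)) |Q|
    u : Unique (f zero ∷ P ++ (y ∷ Q))
    u = subst (λ zs → Unique (f zero ∷ zs)) (sym e) uf
    uPQ = unique-++ (f zero ∷ P) u
    nbP : NonBacktracking (f zero ∷ P)
    nbP = unique⇒nb (proj₁ uPQ)
    nbQ : NonBacktracking (f zero ∷ Q′)
    nbQ = unique⇒nb (unique-∷ (proj₂ (proj₂ uPQ) (here refl) ∘ Anyₚ.reverse⁻)
            (unique-resp-↭ (↭-sym (Permₚ.↭-reverse (y ∷ Q))) (proj₁ (proj₂ uPQ))))
    armP = first-step P p nbP |P|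
    armQ = first-step Q′ q′ nbQ |Q′|
    a = proj₁ armP
    b = proj₁ armQ
    α = proj₂ (proj₂ armP)
    β = proj₂ (proj₂ armQ)
    a≢b : a ≢ b
    a≢b a≡b = proj₂ (proj₂ uPQ) (there (proj₁ (proj₂ armP)))
                (Anyₚ.reverse⁻ (subst (_∈ Q′) (sym a≡b) (proj₁ (proj₂ armQ))))

  codes-total : ∀ {S} → IsCopy (C (suc (l + l))) G S → ∃ (Codes S)
  codes-total {S} (sub , f , iso) = go (split-length (tabulate (f ∘ suc)) l (Listₚ.length-tabulate (f ∘ suc)))
    where
    hom : ∀ {x y} → Adj (C (suc (l + l))) x y → Adj G (f x) (f y)
    hom = iso-hom {H = C (suc (l + l))} {G = G} {S} sub iso
    go : (∃₂ λ P Q → P ++ Q ≡ tabulate (f ∘ suc) × length P ≡ l × length Q ≡ l) → ∃ (Codes S)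
    go (P , [] , e , |P| , |Q|) = ⊥-elim (ℕₚ.<⇒≢ l≥1 |Q|)
    go (P , y ∷ Q , e , |P| , |Q|) =
      let (x , p , r , w) = cutʷ P (subst (λ zs → Walk (Adj G) (f zero) zs (f (fromℕ (l + l)))) (sym e)
                                               (hom-walk {G = G} hom))
      in _ , codes-cycle sub iso e (Uniqueₚ.tabulate⁺ (IsIsomorphism.injective iso)) |P| |Q| p r w
               (hom (C-close (ℕₚ.≤-trans l≥1 (ℕₚ.m≤m+n l l))))

  coded-length : ∀ {Ss} → Unique Ss → (∀ {S} → S ∈ Ss → IsCopy (C (suc (l + l))) G S) →
                 length Ss ≤ n * (n * D)
  coded-length u copy with relabel Codes codes-injective u (codes-total ∘ copy)
  ... | ts , uts , len , src = subst (_≤ n * (n * D)) len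
          (opposite-triples uts λ t∈ → let (_ , _ , _ , opp , _) = src t∈ in opp)

  copies-bound : copies (C (suc (l + l))) G ≤ n * (n * D)
  copies-bound = length-filter-≤ (isCopy? (C (suc (l + l))) G) (subgraphData-unique n) coded-length

-- From forbidden cycles to the bound on `ex`.

free⇒no-cycle : ∀ {k l} {G : Graph n} → Free (forbidden k l) G → ∀ {x xs} → Cycle (Adj G) x xs →
  3 ≤ length xs → length xs ≤ l + l → ⊥
free⇒no-cycle {k = k} {l} {G} free {xs = xs} cyc lo hi with ℕₚ.m≤n⇒∃[o]m+o≡n lo
... | i , e = All.lookup (Allₚ.++⁻ˡ (applyUpTo _ (2 * l ∸ 2)) free)
    (∈-applyUpTo⁺ _ {i = i} i<) (subst (λ m → Contains G (C m)) (sym e) (cycle⇒contains {G = G} cyc))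
  where
  i< : i < 2 * l ∸ 2
  i< = ℕₚ.m+n≤o⇒m≤o∸n (suc i) (subst₂ _≤_ (trans (sym e) (ℕₚ.+-comm 2 (suc i))) (cong (l +_) (sym (ℕₚ.+-identityʳ l))) hi)

free⇒no-long-cycle : ∀ {k l} {G : Graph n} → Free (forbidden k l) G → ∀ {x xs} → Cycle (Adj G) x xs →
  length xs ≡ 2 * k + 1 → ⊥
free⇒no-long-cycle {k = k} {l} {G} free cyc e =
  All.lookup (Allₚ.++⁻ʳ (applyUpTo _ (2 * l ∸ 2)) free) (here refl)
    (subst (λ m → Contains G (C m)) e (cycle⇒contains {G = G} cyc))

ex-≤ : ∀ {n h} {H : Graph h} {𝓕} {b} → (∀ (G : Graph n) → Free 𝓕 G → copies H G ≤ b) → ex n H 𝓕 ≤ b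
ex-≤ {n} {H = H} {𝓕} {b} bound = max≤v⁺ z≤n (All.tabulate go)
  where
  go : ∀ {c} → c ∈ map (copies H) (filter (free? 𝓕) (graphs n)) → c ≤ b
  go c∈ = let (G , G∈ , c≡) = ∈-map⁻ (copies H) c∈
          in subst (_≤ b) (sym c≡) (bound G (proj₂ (∈-filter⁻ (free? 𝓕) {xs = graphs n} G∈)))

-- For `k` equal to `l + q`, two arms and a path of length `suc (q * 2)` add up to the long
-- forbidden length.
length-long : ∀ l q → l + l + suc (q * 2) ≡ 2 * (l + q) + 1
length-long = solve-∀

copies-of-free : ∀ l q → 1 ≤ l → (G : Graph n) → Free (forbidden (l + q) l) G →
  copies (C (suc (l + l))) G ≤ n * (n * ((2 + q * 2) + (2 + q * 2)))
copies-of-free l q l≥1 G free = CopyCount.copies-bound G l q l≥1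
  (free⇒no-cycle {k = l + q} {l} {G} free)
  (λ cyc e → free⇒no-long-cycle {k = l + q} {l} {G} free cyc (trans e (length-long l q)))

bounded⇒O[n²] : {f : ℕ → ℕ} (D : ℕ) → (∀ n → f n ≤ n * (n * D)) → f =O[n^ 2 ]
bounded⇒O[n²] {f} D bound = D , 0 , λ n _ → subst (f n ≤_) (regroup n D) (bound n)
  where
  regroup : ∀ n D → n * (n * D) ≡ D * (n * (n * 1))
  regroup = solve-∀

upper-bound-offset : ∀ l q → 1 ≤ l → (λ n → ex n (C (suc (l + l))) (forbidden (l + q) l)) =O[n^ 2 ]
upper-bound-offset l q l≥1 = bounded⇒O[n²] ((2 + q * 2) + (2 + q * 2))
   (λ n → ex-≤ {n = n} {H = C (suc (l + l))} {forbidden (l + q) l} (copies-of-free l q l≥1))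

upper-bound : ∀ k l → 1 ≤ l → l < k → (λ n → ex n (C (suc (l + l))) (forbidden k l)) =O[n^ 2 ]
upper-bound k l l≥1 l<k =
  let (q , l+q≡k) = ℕₚ.m≤n⇒∃[o]m+o≡n (ℕₚ.<⇒≤ l<k)
  in subst (λ k → (λ n → ex n (C (suc (l + l))) (forbidden k l)) =O[n^ 2 ]) l+q≡k (upper-bound-offset l q l≥1)

-- The lower bound

-- Cuts the cycle at `y` and swaps the two pieces. The closing edge is returned separately, so that
-- both neighbours of `y` are at hand.
rotate : {R : A → A → Set} → Cycle R x xs → y ∈ xs →
         ∃₂ λ zs w → Walk R y zs w × R w y × Unique (y ∷ zs) × y ∷ zs ↭ xs
rotate {x = x} {y = y} {R = R} (w , uniq) y∈ with ∈-∃++ y∈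
... | as , bs , e with cutʷ as (subst (λ zs → Walk R x zs x) e w)
... | c , p , r , q = bs ++ as , c , q ++ʷ p , r , unique-resp-↭ (↭-sym perm) uniq , perm
  where
  perm = subst (y ∷ bs ++ as ↭_) (sym e)
           (↭-trans (prep y (Permₚ.++-comm bs as)) (↭-sym (Permₚ.shift y as bs)))

two-neighbours : {R : A → A → Set} → Symmetric R → Cycle R x xs → 3 ≤ length xs → y ∈ xs →
                 ∃₂ λ a b → a ≢ b × a ∈ xs × b ∈ xs × R y a × R y b
two-neighbours s cyc len y∈ with rotate cyc y∈
... | []         , _ , _ , _ , _ , p with subst (3 ≤_) (sym (Permₚ.↭-length p)) len
...   | s≤s ()
two-neighbours s cyc len y∈ | _ ∷ []     , _ , _ , _ , _ , p with subst (3 ≤_) (sym (Permₚ.↭-length p)) len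
...   | s≤s (s≤s ())
two-neighbours s cyc len y∈ | a ∷ a′ ∷ zs , b , r ∷ (r′ ∷ w) , rb , (_ ∷ uniq) , p =
  a , b , (λ { refl → unique-∉ uniq b∈ }) , Permₚ.∈-resp-↭ p (there (here refl)) ,
  Permₚ.∈-resp-↭ p (there (there b∈)) , r , s rb
  where
  b∈ : b ∈ a′ ∷ zs
  b∈ = end-∈ (r′ ∷ w)

next-functional : ∀ {i j j′ : Fin m} → Next m i j → Next m i j′ → j ≡ j′
next-functional (inj₁ e)       (inj₁ e′)       = Finₚ.toℕ-injective (trans (sym e) e′)
next-functional {j = j} (inj₁ e) (inj₂ (e′ , _)) = ⊥-elim (ℕₚ.<⇒≢ (Finₚ.toℕ<n j) (trans (sym e) e′))
next-functional {j′ = j} (inj₂ (e , _)) (inj₁ e′) = ⊥-elim (ℕₚ.<⇒≢ (Finₚ.toℕ<n j) (trans (sym e′) e))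
next-functional (inj₂ (_ , e)) (inj₂ (_ , e′)) = Finₚ.toℕ-injective (trans e (sym e′))

next-injective : ∀ {i i′ j : Fin m} → Next m i j → Next m i′ j → i ≡ i′
next-injective (inj₁ e)       (inj₁ e′)       = Finₚ.toℕ-injective (ℕₚ.suc-injective (trans e (sym e′)))
next-injective (inj₁ e)       (inj₂ (_ , e′)) with () ← trans e e′
next-injective (inj₂ (_ , e)) (inj₁ e′)       with () ← trans e′ e
next-injective (inj₂ (e , _)) (inj₂ (e′ , _)) = Finₚ.toℕ-injective (ℕₚ.suc-injective (trans e (sym e′)))

-- The two neighbours of a vertex on a cycle in C r are all its neighbours in
-- C r, so the cycle is closed under the successor map.
module _ {m} {x : Fin (suc m)} {xs} (cyc : Cycle (Adj (C (suc m))) x xs) (len : 3 ≤ length xs) where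

  private
    closed : ∀ {u j} → u ∈ xs → Next (suc m) u j → j ∈ xs
    closed {u} {j} u∈ next = pick (two-neighbours (λ {i} {j} → symm (C (suc m)) {i} {j}) cyc len u∈)
      where
      pick : (∃₂ λ a b → a ≢ b × a ∈ xs × b ∈ xs × Adj (C (suc m)) u a × Adj (C (suc m)) u b) → j ∈ xs
      pick (a , b , a≢b , a∈ , b∈ , (_ , inj₁ s) , _) = subst (_∈ xs) (next-functional s next) a∈
      pick (a , b , a≢b , a∈ , b∈ , _ , (_ , inj₁ s)) = subst (_∈ xs) (next-functional s next) b∈
      pick (a , b , a≢b , a∈ , b∈ , (_ , inj₂ s) , (_ , inj₂ s′)) = ⊥-elim (a≢b (next-injective s s′))

    up : ∀ {u} → u ∈ xs → ∀ d j → d + toℕ u ≡ toℕ j → j ∈ xs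
    up u∈ zero    j e = subst (_∈ xs) (Finₚ.toℕ-injective e) u∈
    up {u} u∈ (suc d) j e = closed (up u∈ d i (sym i≡)) (inj₁ (trans (cong suc i≡) e))
      where
      i = fromℕ< (ℕₚ.<-trans (subst (d + toℕ u <_) e ℕₚ.≤-refl) (Finₚ.toℕ<n j))
      i≡ : toℕ i ≡ d + toℕ u
      i≡ = Finₚ.toℕ-fromℕ< _

    all∈ : ∀ {u} → u ∈ xs → ∀ j → j ∈ xs
    -- Upwards from `u` to the last vertex, over the closing edge to `zero`, then up to `j`.
    all∈ {u} u∈ j = up zero∈ (toℕ j) j (ℕₚ.+-identityʳ _)
      where
      last∈ : fromℕ m ∈ xs
      last∈ = up u∈ (m ∸ toℕ u) (fromℕ m)
                (trans (ℕₚ.m∸n+n≡m (s≤s⁻¹ (Finₚ.toℕ<n u))) (sym (Finₚ.toℕ-fromℕ m)))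
      zero∈ : zero ∈ xs
      zero∈ = closed last∈ (inj₂ (cong suc (Finₚ.toℕ-fromℕ m) , refl))

    some∈ : ∀ {xs : List (Fin (suc m))} → 3 ≤ length xs → ∃ (_∈ xs)
    some∈ {x ∷ _} _ = x , here refl

  C-cycle-length : length xs ≡ suc m
  C-cycle-length = ℕₚ.≤-antisym
    (subst (length xs ≤_) |Fin| (unique-⊆-length (proj₂ cyc) (λ {i} _ → ∈-allFin i)))
    (subst (_≤ length xs) |Fin| (unique-⊆-length (Uniqueₚ.allFin⁺ (suc m)) (λ {i} _ → all∈ (proj₂ (some∈ len)) i)))
    where
    |Fin| : length (allFin (suc m)) ≡ suc m
    |Fin| = Listₚ.length-tabulate {n = suc m} id

-- Bridge b: a path of at most b old edges between two distinct vertices carrying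
-- new edges.  A cycle that uses both kinds of edges contains one.
module Crossing {A : Set} (Old New : A → A → Set) (On : A → Set)
  (on : ∀ {x y} → New x y → On x × On y) where

  Either : A → A → Set
  Either x y = Old x y ⊎ New x y

  Bridge : ℕ → Set
  Bridge b = ∃₂ λ u w → ∃[ seg ] On u × On w × u ≢ w × Walk Old u seg w × length seg ≤ b

  bridge-weaken : ∀ {b b′} → b ≤ b′ → Bridge b → Bridge b′
  bridge-weaken le (u , w , seg , ou , ow , u≢w , p , l) = u , w , seg , ou , ow , u≢w , p , ℕₚ.≤-trans l le

  find-new : ∀ {x xs y} → Walk Either x xs y → Walk Old x xs y ⊎
    ∃₂ λ as u → ∃₂ λ w bs → xs ≡ as ++ w ∷ bs × Walk Either x as u × New u w × Walk Either w bs y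
  find-new []           = inj₁ []
  find-new (inj₂ s ∷ w) = inj₂ ([] , _ , _ , _ , refl , [] , s , w)
  find-new (inj₁ r ∷ w) with find-new w
  ... | inj₁ v = inj₁ (r ∷ v)
  ... | inj₂ (as , u , v , bs , refl , p , s , q) = inj₂ (_ ∷ as , u , v , bs , refl , inj₁ r ∷ p , s , q)

  -- Old edges are followed from `u` until a new edge starts or the walk ends at `b`. Either
  -- stopping point satisfies `On`, and it differs from `u` because `u` is not revisited.
  reach-new : ∀ {u seg a ws b} → On u → Walk Old u seg a → Walk Either a ws b → u ∉ a ∷ ws → On b →
              Bridge (length seg + length ws)
  reach-new ou p [] u∉ ob = _ , _ , _ , ou , ob , (u∉ ∘ here) , p , ℕₚ.m≤m+n _ 0
  reach-new ou p (inj₂ s ∷ w) u∉ ob = _ , _ , _ , ou , proj₁ (on s) , (u∉ ∘ here) , p , ℕₚ.m≤m+n _ _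
  reach-new {seg = seg} {ws = v ∷ ws} ou p (inj₁ r ∷ w) u∉ ob =
    bridge-weaken (ℕₚ.≤-reflexive (trans (cong (_+ length ws) (Listₚ.length-++ seg)) (ℕₚ.+-assoc (length seg) 1 _)))
      (reach-new ou (p ++ʷ (r ∷ [])) w (u∉ ∘ there) ob)

  scan : ∀ {a ws b} → Walk Either a ws b → Unique (a ∷ ws) → On a → On b →
         Walk New a ws b ⊎ Bridge (length ws)
  scan [] u oa ob = inj₁ []
  scan (inj₁ r ∷ w) u oa ob = inj₂ (reach-new oa (r ∷ []) w (unique-∉ u) ob)
  scan (inj₂ s ∷ w) u oa ob = Sum.map (s ∷_) (bridge-weaken (ℕₚ.n≤1+n _)) (scan w (unique-tail u) (proj₂ (on s)) ob)

  cycle-cases : ∀ {x xs} → Cycle Either x xs → Cycle Old x xs ⊎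
    (∃₂ λ y ys → Cycle New y ys × length ys ≡ length xs) ⊎ Bridge (length xs)
  cycle-cases (w , uniq) with find-new w
  ... | inj₁ v = inj₁ (v , uniq)
  ... | inj₂ (as , u , v , bs , refl , p , s , q)
    -- The cycle is rotated to begin with the new edge `s`, so both ends of the remaining walk carry
    -- a new edge.
    with scan (q ++ʷ p) uniq′ (proj₂ (on s)) (proj₁ (on s))
    where
    uniq′ : Unique (v ∷ bs ++ as)
    uniq′ = unique-resp-↭ (↭-trans (Permₚ.shift v as bs) (prep v (Permₚ.++-comm as bs))) uniq
  ...   | inj₁ c = inj₂ (inj₁ (u , v ∷ bs ++ as , (s ∷ c , uniq′) , Permₚ.↭-length perm))
    where
    perm : v ∷ bs ++ as ↭ as ++ v ∷ bs
    perm = ↭-sym (↭-trans (Permₚ.shift v as bs) (prep v (Permₚ.++-comm as bs)))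
    uniq′ : Unique (v ∷ bs ++ as)
    uniq′ = unique-resp-↭ (↭-sym perm) uniq
  ...   | inj₂ br = inj₂ (inj₂ (bridge-weaken le br))
    where
    le : length (bs ++ as) ≤ length (as ++ v ∷ bs)
    le = ℕₚ.≤-trans (ℕₚ.n≤1+n _) (ℕₚ.≤-reflexive (Permₚ.↭-length
           (↭-sym (↭-trans (Permₚ.shift v as bs) (prep v (Permₚ.++-comm as bs))))))

-- Balls, and choosing vertices far apart.

infix 4 _∈?_

_∈?_ : (i : Fin n) (is : List (Fin n)) → Dec (i ∈ is)
_∈?_ = DecMembership._∈?_ Finₚ._≟_

length-concatMap-≤ : (f : A → List B) {b : ℕ} → (∀ x → length (f x) ≤ b) → ∀ xs →
                     length (concatMap f xs) ≤ length xs * b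
length-concatMap-≤ f     bound []       = z≤n
length-concatMap-≤ f {b} bound (x ∷ xs) = subst (_≤ b + length xs * b) (sym (Listₚ.length-++ (f x)))
                                        (ℕₚ.+-mono-≤ (bound x) (length-concatMap-≤ f bound xs))

length-filter-< : ∀ {A : Set} {x xs} {P Q : A → Set} (P? : U.Decidable P) (Q? : U.Decidable Q) → (∀ {x} → P x → Q x) →
  Unique xs → x ∈ xs → ¬ P x → Q x → length (filter P? xs) < length (filter Q? xs)
length-filter-< {x = x} {xs} P? Q? P⊆Q u x∈ ¬px qx = unique-⊆-length
  (unique-∷ (λ x∈P → ¬px (proj₂ (∈-filter⁻ P? {xs = xs} x∈P))) (Uniqueₚ.filter⁺ P? u)) sub
  where
  sub : ∀ {y} → y ∈ x ∷ filter P? xs → y ∈ filter Q? xs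
  sub (here refl) = ∈-filter⁺ Q? x∈ qx
  sub (there y∈)  = let (y∈xs , py) = ∈-filter⁻ P? {xs = xs} y∈ in ∈-filter⁺ Q? y∈xs (P⊆Q py)

module Ball {A : Set} (R : A → A → Set) (nbrs : A → List A) (complete : ∀ {x y} → R x y → y ∈ nbrs x) where

  ball : ℕ → A → List A
  ball zero    x = [ x ]
  ball (suc m) x = x ∷ concatMap (ball m) (nbrs x)

  ∈-ball : ∀ m {x xs y} → Walk R x xs y → length xs ≤ m → y ∈ ball m x
  ∈-ball zero    []      _         = here refl
  ∈-ball (suc m) []      _         = here refl
  ∈-ball (suc m) (r ∷ w) (s≤s len) = there (∈-concatMap⁺ (ball m) (lose (complete r) (∈-ball m w len)))

  -- Of the `suc Δ` summands `suc Δ ^ m` in the bound, one pays for the centre and the others for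
  -- the balls around the listed neighbours.
  length-ball : ∀ {Δ} → (∀ x → length (nbrs x) ≤ Δ) → ∀ m x → length (ball m x) ≤ suc Δ ^ m
  length-ball deg zero    x = ℕₚ.≤-refl
  length-ball {Δ} deg (suc m) x = ℕₚ.+-mono-≤ (ℕₚ.m^n>0 (suc Δ) m)
    (ℕₚ.≤-trans (length-concatMap-≤ (ball m) (length-ball deg m) (nbrs x)) (ℕₚ.*-monoˡ-≤ (suc Δ ^ m) (deg x)))

Sparse : (M r : ℕ) → Graph n → Set
Sparse M r G = ∀ {x xs} → Cycle (Adj G) x xs → 3 ≤ length xs → length xs ≤ M → length xs ≡ r

Far : (M : ℕ) → Graph n → Fin n → Fin n → Set
Far M G u w = ∀ {seg} → Walk (Adj G) u seg w → length seg ≤ M → ⊥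

far-sym : (M : ℕ) (G : Graph n) → ∀ {u w} → Far M G u w → Far M G w u
far-sym M G far {seg} p len with joinʷ (symm G) p []
... | zs , q , e = far q (subst (_≤ M) (sym |zs|) len)
  where
  |zs| : length zs ≡ length seg
  |zs| = ℕₚ.suc-injective (trans (cong length e) (trans (Listₚ.length-ʳ++ seg) (ℕₚ.+-comm (length seg) 1)))

-- Greedy: the head `v` is taken and its ball, at most `b` vertices, is discarded from the
-- candidates.
scattered : (M : ℕ) (G : Graph n) (b : ℕ) (ball : Fin n → List (Fin n)) → 1 ≤ b →
  (∀ v → length (ball v) ≤ b) → (∀ {u w} → w ∉ ball u → Far M G u w) →
  ∀ r {A} → Unique A → r * b ≤ length A →
  Σ (Fin r → Fin n) λ f → (∀ i → f i ∈ A) × (∀ i j → i ≢ j → Far M G (f i) (f j))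
scattered M G b ball b≥1 small far zero    u le = (λ ()) , (λ ()) , λ ()
scattered M G b ball b≥1 small far (suc r) {[]} u le =
  ⊥-elim (ℕₚ.<⇒≱ (ℕₚ.≤-trans b≥1 (ℕₚ.m≤m+n b (r * b))) le)
scattered {n = n} M G b ball b≥1 small far (suc r) {A@(v ∷ _)} u le
  with scattered M G b ball b≥1 small far r {filter (λ x → ¬? (x ∈? ball v)) A} (Uniqueₚ.filter⁺ (λ x → ¬? (x ∈? ball v)) u)
         (ℕₚ.+-cancelˡ-≤ b _ _ (ℕₚ.≤-trans le (ℕₚ.≤-trans (length-filter-∉ Finₚ._≟_ u (ball v))
           (subst (_≤ b + length rest) (ℕₚ.+-comm (length (ball v)) _) (ℕₚ.+-monoˡ-≤ _ (small v))))))
  where rest = filter (λ x → ¬? (x ∈? ball v)) A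
... | f , f∈ , apart = g , g∈ , g-apart
  where
  f∈A : ∀ i → f i ∈ A × f i ∉ ball v
  f∈A i = ∈-filter⁻ (λ x → ¬? (x ∈? ball v)) {xs = A} (f∈ i)
  g : Fin (suc r) → Fin n
  g zero    = v
  g (suc i) = f i
  g∈ : ∀ i → g i ∈ A
  g∈ zero    = here refl
  g∈ (suc i) = proj₁ (f∈A i)
  g-apart : ∀ i j → i ≢ j → Far M G (g i) (g j)
  g-apart zero    zero    i≢j = ⊥-elim (i≢j refl)
  g-apart zero    (suc j) _   = far (proj₂ (f∈A j))
  g-apart (suc i) zero    _   = far-sym M G (far (proj₂ (f∈A i)))
  g-apart (suc i) (suc j) i≢j = apart i j (i≢j ∘ cong suc)

-- Adding cycles on far-apart vertices, one by one and in rounds.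

addImage : (G : Graph n) (H : Graph h) {f : Fin h → Fin n} → Injective _≡_ _≡_ f → Graph n
addImage G H {f} inj = record
  { Adj    = λ i j → Adj G i j ⊎ ImageAdj H f i j
  ; adj?   = λ i j → adj? G i j ⊎-dec imageAdj? H f i j
  ; symm   = Sum.map (symm G) (imageAdj-sym H f)
  ; irrefl = λ { i (inj₁ a) → irrefl G i a
               ; i (inj₂ (x , y , fx , fy , a)) →
                   irrefl H x (subst (Adj H x) (inj (trans fy (sym fx))) a) }
  }

pullback : {H : Graph h} {f : Fin h → Fin n} → Injective _≡_ _≡_ f → ∀ {x i is j} → f x ≡ i →
  Walk (ImageAdj H f) i is j → ∃₂ λ xs y → Walk (Adj H) x xs y × map f xs ≡ is × f y ≡ j
pullback inj fx [] = [] , _ , [] , refl , fx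
pullback {H = H} {f} inj {x} fx ((x′ , y , fx′ , fy , a) ∷ w) =
  let (xs , z , v , e , fz) = pullback {H = H} inj fy w
  in y ∷ xs , z , subst (λ x → Adj H x y) (inj (trans fx′ (sym fx))) a ∷ v , cong₂ _∷_ fy e , fz

module _ {M m : ℕ} {G : Graph n} {f : Fin (suc m) → Fin n} (1≤M : 1 ≤ M) (1≤m : 1 ≤ m)
         (apart : ∀ i j → i ≢ j → Far M G (f i) (f j)) where

  apart⇒injective : Injective _≡_ _≡_ f
  apart⇒injective {i} {j} e = decidable-stable (i Finₚ.≟ j) λ i≢j →
    -- Equal vertices are joined by the empty walk.
    apart i j i≢j (subst (Walk (Adj G) (f i) []) e []) z≤n

  private
    inj = apart⇒injective

  -- Such a cycle pulls back along the injective `f` to a cycle in `C (suc m)`, where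
  -- `C-cycle-length` applies.
  image-cycle-length : ∀ {i is} → Cycle (ImageAdj (C (suc m)) f) i is → 3 ≤ length is → length is ≡ suc m
  image-cycle-length {is = is} (w@((x , _ , fx , _) ∷ _) , u) len =
    let (xs , y , v , e , fy) = pullback {H = C (suc m)} inj fx w
        |xs| : length is ≡ length xs
        |xs| = trans (sym (cong length e)) (Listₚ.length-map f xs)
    in trans |xs| (C-cycle-length
         (subst (Walk (Adj (C (suc m))) x xs) (inj (trans fy (sym fx))) v ,
          Uniqueₚ.map⁻ (subst Unique (sym e) u))
         (subst (3 ≤_) |xs| len))

  addCycle : Graph n
  addCycle = addImage G (C (suc m)) {f} inj

  -- An all-old cycle is covered by `sparse`, an all-new one by `image-cycle-length`. A mixed one
  -- would contain a short old path between two distinct vertices of the image of `f`, which are far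
  -- apart.
  addCycle-sparse : Sparse M (suc m) G → Sparse M (suc m) addCycle
  addCycle-sparse sparse cyc lo hi
    with Crossing.cycle-cases (Adj G) (ImageAdj (C (suc m)) f) (λ i → ∃[ x ] f x ≡ i)
           (λ (x , y , fx , fy , _) → (x , fx) , (y , fy)) cyc
  ... | inj₁ cyc′ = sparse cyc′ lo hi
  ... | inj₂ (inj₁ (y , ys , cyc′ , e)) = trans (sym e) (image-cycle-length cyc′ (subst (3 ≤_) (sym e) lo))
  ... | inj₂ (inj₂ (_ , _ , seg , (x , refl) , (y , refl) , x≢y , w , len)) =
        ⊥-elim (apart x y (x≢y ∘ cong f) w (ℕₚ.≤-trans len hi))

  -- Old copies survive, and the image of `f` is a further one: in `G` its closing edge would join
  -- two far-apart vertices.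
  addCycle-copies : copies (C (suc m)) G < copies (C (suc m)) addCycle
  addCycle-copies = length-filter-< (isCopy? (C (suc m)) G) (isCopy? (C (suc m)) addCycle)
    extend (subgraphData-unique n) (∈-subgraphData (image (C (suc m)) f)) new
    (image-isCopy (C (suc m)) f addCycle inj (λ a → inj₂ (_ , _ , refl , refl , a)))
    where
    extend : ∀ {S} → IsCopy (C (suc m)) G S → IsCopy (C (suc m)) addCycle S
    extend (sub , iso) = record
      { edge-sym = IsSubgraph.edge-sym sub ; edge-ends = IsSubgraph.edge-ends sub
      ; edge-sub = λ i j e → inj₁ (IsSubgraph.edge-sub sub i j e) } , iso
    last≢zero : fromℕ m ≢ zero
    last≢zero = proj₁ (C-close 1≤m)
    new : ¬ IsCopy (C (suc m)) G (image (C (suc m)) f)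
    new (sub , _) = apart (fromℕ m) zero last≢zero
      (IsSubgraph.edge-sub sub _ _ (image-edge⁺ (C (suc m)) f (_ , _ , refl , refl , C-close 1≤m)) ∷ []) 1≤M

-- The state within a round. `available` holds vertices not yet used in the round, whose degree is
-- still at most the initial bound `a`; used ones gain at most `suc m`. `nbrs` may list more than
-- the actual neighbours.
record Packing (n M m a t : ℕ) (available : List (Fin n)) : Set₁ where
  field
    G        : Graph n
    nbrs     : Fin n → List (Fin n)
    complete : ∀ {i j} → Adj G i j → j ∈ nbrs i
    unique   : Unique available
    light    : ∀ {i} → i ∈ available → length (nbrs i) ≤ a
    bounded  : ∀ i → length (nbrs i) ≤ a + suc m
    sparse   : Sparse M (suc m) G
    many     : t ≤ copies (C (suc m)) G

module _ {n M m b : ℕ} (1≤M : 1 ≤ M) (1≤m : 1 ≤ m) where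

  extend : ∀ {a t A} → suc (a + suc m) ^ M ≤ b → suc m * b ≤ length A → Packing n M m a t A →
           ∃[ A′ ] Packing n M m a (suc t) A′ × length A ≤ length A′ + suc m
  extend {a} {t} {A} ball≤b room 𝒫 = A′ , packing ,
      subst (λ r → length A ≤ length A′ + r) (Listₚ.length-tabulate f) (length-filter-∉ Finₚ._≟_ unique fs)
    where
    open Packing 𝒫
    open Ball (Adj G) nbrs complete
    far : ∀ {u w} → w ∉ ball M u → Far M G u w
    far w∉ p len = w∉ (∈-ball M p len)
    ball≤ : ∀ v → length (ball M v) ≤ b
    ball≤ v = ℕₚ.≤-trans (length-ball bounded M v) ball≤b
    choice = scattered M G b (ball M) (ℕₚ.≤-trans (ℕₚ.m^n>0 (suc (a + suc m)) M) ball≤b) ball≤ far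
               (suc m) unique room
    f = proj₁ choice
    f∈ = proj₁ (proj₂ choice)
    apart = proj₂ (proj₂ choice)
    fs = tabulate f
    fs⊆A : ∀ {i} → i ∈ fs → i ∈ A
    fs⊆A i∈ = let (x , e) = ∈-tabulate⁻ {f = f} i∈ in subst (_∈ A) (sym e) (f∈ x)
    A′ = filter (λ i → ¬? (i ∈? fs)) A
    A′⁻ : ∀ {i} → i ∈ A′ → i ∈ A × i ∉ fs
    A′⁻ = ∈-filter⁻ (λ i → ¬? (i ∈? fs)) {xs = A}
    nbrs′ : ∀ i → Dec (i ∈ fs) → List (Fin n)
    -- All vertices of the new cycle are listed instead of the two neighbours of `i`; the cruder
    -- degree bound only costs a constant factor.
    nbrs′ i (yes _) = fs ++ nbrs i
    nbrs′ i (no _)  = nbrs i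
    complete′ : ∀ {i j} d → Adj G i j ⊎ ImageAdj (C (suc m)) f i j → j ∈ nbrs′ i d
    complete′ (yes _) (inj₁ e) = ∈-++⁺ʳ fs (complete e)
    complete′ (no _)  (inj₁ e) = complete e
    complete′ (yes _) (inj₂ (x , y , fx , refl , _)) = ∈-++⁺ˡ (∈-tabulate⁺ {f = f} y)
    complete′ (no i∉) (inj₂ (x , y , refl , fy , _)) = ⊥-elim (i∉ (∈-tabulate⁺ {f = f} x))
    light′ : ∀ {i} d → i ∈ A → i ∉ fs → length (nbrs′ i d) ≤ a
    light′ (yes i∈) _  i∉ = ⊥-elim (i∉ i∈)
    light′ (no _)   i∈ _  = light i∈
    bounded′ : ∀ i d → length (nbrs′ i d) ≤ a + suc m
    bounded′ i (no _)   = bounded i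
    bounded′ i (yes i∈) = ℕₚ.≤-trans (ℕₚ.≤-reflexive (trans (Listₚ.length-++ fs) (ℕₚ.+-comm (length fs) _)))
      (ℕₚ.+-mono-≤ (light (fs⊆A i∈)) (ℕₚ.≤-reflexive (Listₚ.length-tabulate f)))
    packing : Packing n M m a (suc t) A′
    packing = record
      { G        = addCycle {G = G} {f} 1≤M 1≤m apart
      ; nbrs     = λ i → nbrs′ i (i ∈? fs)
      ; complete = λ {i} → complete′ (i ∈? fs)
      ; unique   = Uniqueₚ.filter⁺ (λ i → ¬? (i ∈? fs)) unique
      ; light    = λ {i} i∈ → light′ (i ∈? fs) (proj₁ (A′⁻ i∈)) (proj₂ (A′⁻ i∈))
      ; bounded  = λ i → bounded′ i (i ∈? fs)
      ; sparse   = addCycle-sparse {G = G} {f} 1≤M 1≤m apart sparse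
      ; many     = ℕₚ.≤-trans (s≤s many) (addCycle-copies {G = G} {f} 1≤M 1≤m apart)
      }

  -- Each addition uses up at most `suc m` available vertices. The term `s * suc m` pays for these,
  -- so that `suc m * b` are left for every greedy choice.
  round : ∀ {a t A} s → suc (a + suc m) ^ M ≤ b → suc m * b + s * suc m ≤ length A → Packing n M m a t A →
          ∃[ A′ ] Packing n M m a (s + t) A′
  round zero ball≤b room 𝒫 = _ , 𝒫
  round {a} {t} {A} (suc s) ball≤b room 𝒫 =
    let (A₁ , 𝒫₁ , len) = extend ball≤b (ℕₚ.≤-trans (ℕₚ.m≤m+n _ _) room) 𝒫
        room₁ = ℕₚ.+-cancelʳ-≤ (suc m) _ (length A₁) (ℕₚ.≤-trans (ℕₚ.≤-reflexive (regroup (suc m) b (s * suc m)))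
                  (ℕₚ.≤-trans room len))
        (A₂ , 𝒫₂) = round s ball≤b room₁ 𝒫₁
    in A₂ , subst (λ t → Packing n M m a t A₂) (ℕₚ.+-suc s t) 𝒫₂
    where
    regroup : ∀ r b x → r * b + x + r ≡ r * b + (r + x)
    regroup = solve-∀

  -- All vertices become available again, at the price of raising the degree bound by `suc m`.
  new-round : ∀ {a t A} → Packing n M m a t A → Packing n M m (suc m + a) t (allFin n)
  new-round {a} 𝒫 = record
    { G = G ; nbrs = nbrs ; complete = complete
    ; unique = Uniqueₚ.allFin⁺ n
    ; light = λ {i} _ → bounded′ i
    ; bounded = λ i → ℕₚ.≤-trans (bounded′ i) (ℕₚ.m≤m+n _ _)
    ; sparse = sparse ; many = many }
    where
    open Packing 𝒫
    bounded′ : ∀ i → length (nbrs i) ≤ suc m + a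
    bounded′ i = subst (length (nbrs i) ≤_) (ℕₚ.+-comm a (suc m)) (bounded i)

  -- `b` has to bound the balls in the last round, where degrees may reach `d * suc m`; the balls of
  -- earlier rounds obey a smaller bound.
  rounds : ∀ d s → suc (d * suc m) ^ M ≤ b → suc m * b + s * suc m ≤ n →
           Packing n M m (d * suc m) (d * s) (allFin n)
  rounds zero    s ball≤b room = record
    { G = record { Adj = λ _ _ → ⊥ ; adj? = λ _ _ → no λ () ; symm = λ () ; irrefl = λ _ () }
    ; nbrs = λ _ → [] ; complete = λ () ; unique = Uniqueₚ.allFin⁺ n
    ; light = λ _ → z≤n ; bounded = λ _ → z≤n
    ; sparse = λ { (([]) , _) () _ ; ((() ∷ _) , _) _ _ } ; many = z≤n }
  rounds (suc d) s ball≤b room = new-round (proj₂ (round s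
      (subst (λ e → suc e ^ M ≤ b) (ℕₚ.+-comm (suc m) (d * suc m)) ball≤b)
      (subst (suc m * b + s * suc m ≤_) (sym (Listₚ.length-tabulate id)) room)
      (rounds d s (ℕₚ.≤-trans (ℕₚ.^-monoˡ-≤ M (s≤s (ℕₚ.m≤n+m _ (suc m)))) ball≤b) room)))

-- The only cycle length from 3 to 2k + 1 left by `Sparse` is 2l + 1, which exceeds all the short
-- forbidden lengths and, as l < k, is less than 2k + 1.
sparse⇒free : ∀ {G : Graph n} → 1 ≤ l → l < k → Sparse (suc (2 * k)) (suc (l + l)) G → Free (forbidden k l) G
sparse⇒free {l = l} {k} {G} 1≤l l<k sparse = Allₚ.++⁺
    (Allₚ.applyUpTo⁺₁ (λ i → 3 + i , C (3 + i)) (2 * l ∸ 2) λ {i} i< contains →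
      let 3+i≤ = short i i< in
      ℕₚ.<⇒≢ (s≤s 3+i≤) (at contains (s≤s (s≤s (s≤s z≤n)))
        (ℕₚ.≤-trans 3+i≤ (ℕₚ.≤-trans (ℕₚ.+-mono-≤ (ℕₚ.<⇒≤ l<k) (ℕₚ.<⇒≤ l<k)) (ℕₚ.≤-trans (ℕₚ.≤-reflexive (double k)) (ℕₚ.n≤1+n _))))))
    ((λ contains → ℕₚ.<⇒≢ l+l<2k (sym (ℕₚ.suc-injective
       (at (subst (λ m → Contains G (C m)) (ℕₚ.+-comm (2 * k) 1) contains) (s≤s 2≤2k) ℕₚ.≤-refl)))) ∷ [])
  where
  double : ∀ k → k + k ≡ 2 * k
  double = solve-∀
  l+l<2k : l + l < 2 * k
  l+l<2k = subst (l + l <_) (double k) (ℕₚ.+-mono-<-≤ l<k (ℕₚ.<⇒≤ l<k))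
  2≤2k : 2 ≤ 2 * k
  2≤2k = ℕₚ.≤-trans (ℕₚ.+-mono-≤ 1≤l 1≤l) (ℕₚ.<⇒≤ l+l<2k)
  short : ∀ i → i < 2 * l ∸ 2 → 3 + i ≤ l + l
  short i i< = subst₂ _≤_ (ℕₚ.+-comm (suc i) 2) (sym (double l))
    (ℕₚ.m≤o∸n⇒m+n≤o (suc i) (subst (2 ≤_) (double l) (ℕₚ.+-mono-≤ 1≤l 1≤l)) i<)
  at : ∀ {m} → Contains G (C (suc m)) → 3 ≤ suc m → suc m ≤ suc (2 * k) → suc m ≡ suc (l + l)
  at {m} contains lo hi =
    let (_ , _ , cyc , e) = contains⇒cycle {G = G} (s≤s⁻¹ (ℕₚ.≤-trans (s≤s (s≤s z≤n)) lo)) contains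
    in trans (sym e) (sparse cyc (subst (3 ≤_) (sym e) lo) (subst (_≤ suc (2 * k)) (sym e) hi))

-- Choosing the parameters of the packing.

root : ∀ q n → ∃[ d ] d ^ suc q ≤ n × n < suc d ^ suc q
root q zero    = 0 , z≤n , ℕₚ.m^n>0 1 (suc q)
root q (suc n) with root q n
... | d , lo , hi with suc d ^ suc q ℕ.≤? suc n
-- When `n` grows by one, its integer root grows by at most one.
...   | yes lo′ = suc d , lo′ , ℕₚ.≤-<-trans hi (ℕₚ.^-monoˡ-< (suc q) ℕₚ.≤-refl)
...   | no ¬lo′ = d , ℕₚ.m≤n⇒m≤1+n lo , ℕₚ.≰⇒> ¬lo′

^-distribʳ-* : ∀ a b q → (a * b) ^ q ≡ a ^ q * b ^ q
^-distribʳ-* a b zero    = refl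
^-distribʳ-* a b (suc q) = trans (cong (a * b *_) (^-distribʳ-* a b q)) (interchange a b (a ^ q) (b ^ q))
  where
  interchange : ∀ a b x y → a * b * (x * y) ≡ a * x * (b * y)
  interchange = solve-∀

module _ (r M : ℕ) .{{_ : ℕ.NonZero r}} where

  private
    instance
      2r≢0 : ℕ.NonZero (2 * r)
      2r≢0 = ℕₚ.m*n≢0 2 r

  -- The constant left over in `balls-fit` once `suc (d * r)` is bounded by `d * suc r`. When `d` is
  -- at least this large, the spare factor `d` in `d ^ suc M` absorbs it.
  threshold : ℕ
  threshold = 2 * r * suc r ^ M

  2r≤threshold : 2 * r ≤ threshold
  2r≤threshold = ℕₚ.m≤m*n (2 * r) (suc r ^ M) {{ℕₚ.m^n≢0 (suc r) M}}

  threshold≤root : ∀ {n d} → threshold ^ suc M ≤ n → n < suc d ^ suc M → threshold ≤ d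
  threshold≤root {n} {d} N≤n hi = ℕₚ.≮⇒≥ λ d<K →
    ℕₚ.<⇒≱ hi (ℕₚ.≤-trans (ℕₚ.^-monoˡ-≤ (suc M) d<K) N≤n)

  balls-fit : ∀ {n d} → 1 ≤ d → threshold ≤ d → d ^ suc M ≤ n → 2 * (r * suc (d * r) ^ M) ≤ n
  balls-fit {n} {d} d≥1 K≤d lo = begin
    2 * (r * suc (d * r) ^ M)      ≤⟨ ℕₚ.*-monoʳ-≤ 2 (ℕₚ.*-monoʳ-≤ r (ℕₚ.^-monoˡ-≤ M (ℕₚ.+-monoˡ-≤ (d * r) d≥1))) ⟩
    2 * (r * (d + d * r) ^ M)      ≡⟨ cong (λ e → 2 * (r * e ^ M)) (sym (ℕₚ.*-suc d r)) ⟩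
    2 * (r * (d * suc r) ^ M)      ≡⟨ cong (λ e → 2 * (r * e)) (^-distribʳ-* d (suc r) M) ⟩
    2 * (r * (d ^ M * suc r ^ M))  ≡⟨ regroup r (d ^ M) (suc r ^ M) ⟩
    threshold * d ^ M              ≤⟨ ℕₚ.*-monoˡ-≤ (d ^ M) K≤d ⟩
    d ^ suc M                      ≤⟨ lo ⟩
    n                              ∎
    where
    open ℕₚ.≤-Reasoning
    regroup : ∀ r x y → 2 * (r * (x * y)) ≡ 2 * r * y * x
    regroup = solve-∀

  -- `d` is the integer root of `n`, so `n` is at most `(2 * d) ^ suc M`; it is also at most
  -- `4 * r * s`. The factors 2 and `4 * r` multiply to the constant `8 * r`.
  lower-arithmetic : ∀ e n → (∀ d s → r * suc (d * r) ^ M + s * r ≤ n → d * s ≤ e) →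
                     threshold ^ suc M ≤ n → n * n ^ suc M ≤ (8 * r * e) ^ suc M
  lower-arithmetic e n many N≤n with root M n
  ... | d , lo , hi = begin
    n * n ^ suc M                                ≤⟨ ℕₚ.*-mono-≤ n≤ (ℕₚ.^-monoˡ-≤ (suc M) n≤4rs) ⟩
    (2 * d) ^ suc M * (4 * r * s) ^ suc M        ≡⟨ ^-distribʳ-* (2 * d) (4 * r * s) (suc M) ⟨
    (2 * d * (4 * r * s)) ^ suc M                ≡⟨ cong (_^ suc M) (regroup r d s) ⟩
    (8 * r * (d * s)) ^ suc M                    ≤⟨ ℕₚ.^-monoˡ-≤ (suc M) (ℕₚ.*-monoʳ-≤ (8 * r) (many d s room)) ⟩
    (8 * r * e) ^ suc M                          ∎
    where
    open ℕₚ.≤-Reasoning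
    regroup : ∀ r d s → 2 * d * (4 * r * s) ≡ 8 * r * (d * s)
    regroup = solve-∀
    double : ∀ a → a + a ≡ 2 * a
    double = solve-∀
    K≤d : threshold ≤ d
    K≤d = threshold≤root N≤n hi
    d≥1 : 1 ≤ d
    d≥1 = ℕₚ.≤-trans (ℕ.>-nonZero⁻¹ (2 * r)) (ℕₚ.≤-trans 2r≤threshold K≤d)
    -- The cycles of one round take at most half of the vertices, and by `balls-fit` the balls need
    -- at most the other half.
    s : ℕ
    s = n / (2 * r)
    s*2r≤n : s * (2 * r) ≤ n
    s*2r≤n = m/n*n≤m n (2 * r)
    n<[1+s]2r : n < suc s * (2 * r)
    n<[1+s]2r = subst (_< suc s * (2 * r)) (sym (m≡m%n+[m/n]*n n (2 * r))) (ℕₚ.+-monoˡ-< (s * (2 * r)) (m%n<n n (2 * r)))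
    2r≤n : 2 * r ≤ n
    2r≤n = ℕₚ.≤-trans 2r≤threshold (ℕₚ.≤-trans K≤d (ℕₚ.≤-trans
             (ℕₚ.m≤m*n d (d ^ M) {{ℕₚ.m^n≢0 d M {{ℕ.>-nonZero d≥1}}}}) lo))
    s≥1 : 1 ≤ s
    s≥1 = ℕₚ.n≢0⇒n>0 λ s≡0 → ℕₚ.<⇒≱ n<[1+s]2r
            (subst (λ s → suc s * (2 * r) ≤ n) (sym s≡0) (subst (_≤ n) (sym (ℕₚ.+-identityʳ _)) 2r≤n))
    n≤4rs : n ≤ 4 * r * s
    n≤4rs = ℕₚ.≤-trans (ℕₚ.<⇒≤ n<[1+s]2r) (ℕₚ.≤-trans (ℕₚ.*-monoˡ-≤ (2 * r) (ℕₚ.+-monoˡ-≤ s s≥1))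
              (ℕₚ.≤-reflexive (regroup′ r s)))
      where
      regroup′ : ∀ r s → (s + s) * (2 * r) ≡ 4 * r * s
      regroup′ = solve-∀
    n≤ : n ≤ (2 * d) ^ suc M
    n≤ = ℕₚ.≤-trans (ℕₚ.<⇒≤ hi) (ℕₚ.^-monoˡ-≤ (suc M)
           (ℕₚ.≤-trans (ℕₚ.+-monoˡ-≤ d d≥1) (ℕₚ.≤-reflexive (double d))))
    room : r * suc (d * r) ^ M + s * r ≤ n
    room = ℕₚ.*-cancelˡ-≤ 2 (begin
      2 * (r * suc (d * r) ^ M + s * r)             ≡⟨ ℕₚ.*-distribˡ-+ 2 (r * suc (d * r) ^ M) (s * r) ⟩
      2 * (r * suc (d * r) ^ M) + 2 * (s * r)       ≤⟨ ℕₚ.+-mono-≤ (balls-fit d≥1 K≤d lo)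
                                                         (ℕₚ.≤-trans (ℕₚ.≤-reflexive (swap r s)) s*2r≤n) ⟩
      n + n                                         ≡⟨ double n ⟩
      2 * n                                         ∎)
      where
      swap : ∀ r s → 2 * (s * r) ≡ s * (2 * r)
      swap = solve-∀

copies≤ex : ∀ {n M m t A} {𝓕} → (∀ (G : Graph n) → Sparse M (suc m) G → Free 𝓕 G) →
            ∀ {a} → Packing n M m a t A → t ≤ ex n (C (suc m)) 𝓕
copies≤ex {m = m} {𝓕 = 𝓕} free 𝒫 = ℕₚ.≤-trans many (ex-upper (C (suc m)) 𝓕 G (free G sparse))
  where open Packing 𝒫

-- `M` is 2k + 1 here, so `n * n ^ suc M` is `n ^ (3 + 2 * k)`, and (2k + 3)/(2k + 2) is 1 + 1/(2k +
-- 2).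
lower-bound : ∀ k l → 1 ≤ l → l < k →
  (λ n → ex n (C (suc (l + l))) (forbidden k l)) =Ω[n^ (3 + 2 * k) / (2 + 2 * k) ]
lower-bound k l 1≤l l<k = 8 * suc (l + l) , s≤s z≤n , threshold (suc (l + l)) (suc (2 * k)) ^ (2 + 2 * k) , λ n N≤n →
  lower-arithmetic (suc (l + l)) (suc (2 * k)) (ex n (C (suc (l + l))) (forbidden k l)) n
    (λ d s room → copies≤ex (λ G sparse → sparse⇒free {G = G} 1≤l l<k (λ {x} {xs} → sparse {x} {xs}))
       (rounds (s≤s z≤n) (ℕₚ.≤-trans 1≤l (ℕₚ.m≤m+n l l)) d s ℕₚ.≤-refl room))
    N≤n

theorem14 : ∀ (k l : ℕ) → 2 ≤ l → l < k →
    ((λ n → ex n (C (2 * l + 1)) (forbidden k l)) =Ω[n^ (3 + 2 * k) / (2 + 2 * k) ])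
    × ((λ n → ex n (C (2 * l + 1)) (forbidden k l)) =O[n^ 2 ])
theorem14 k l 2≤l l<k =
  subst (λ r → ((λ n → ex n (C r) (forbidden k l)) =Ω[n^ (3 + 2 * k) / (2 + 2 * k) ])
             × ((λ n → ex n (C r) (forbidden k l)) =O[n^ 2 ]))
        (odd l) (lower-bound k l 1≤l l<k , upper-bound k l 1≤l l<k)
  where
  1≤l : 1 ≤ l
  1≤l = ℕₚ.<⇒≤ 2≤l
  odd : ∀ l → suc (l + l) ≡ 2 * l + 1
  odd = solve-∀
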